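{- Let $F(x,y)=ax^4+bx^3y+cx^2y^2+dxy^3+ey^4$ be an integral binary quartic form with $a\neq0$ and $b\neq 0$. Let $p>3$ be a prime with $\nu_p(b)>0$. Then $R(F)$ is dense in $\mathbb{Q}_p$ if one of the following holds: (1) $p\equiv 1\pmod 3$, $a^2c^2+12a^3e\equiv 0\pmod p$, and $8a^3c^3+27a^4d^2$ is a cubic non-residue modulo $p$; (2) $a^2c^2+12a^3e\not\equiv 0\pmod p$ and $s_{p+1}\equiv a^2c^2-4a^3e\pmod p$, where the sequence $(s_n)$ is defined by $s_0=3$, $s_1=-2ac$, $s_2=2a^2c^2+8a^3e$, and $s_{n+3}=-2acs_{n+2}+(4a^3e-a^2c^2)s_{n+1}+a^4d^2s_n$ for $n\geq 0$.
   Context: $\nu_p$ is the $p$-adic valuation. $R(F)=\{F(x_1,y_1)/F(x_2,y_2) : x_i,y_i\in\mathbb{Z},\ F(x_2,y_2)\neq 0\}$, and density is in the $p$-adic topology. -}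

module Defs where

open import Data.Nat.Base as ℕ using (ℕ; zero; suc)
import Data.Nat.Divisibility as ℕ
open import Data.Nat.Coprimality using (1-coprimeTo) renaming (sym to coprime-sym)
open import Data.Integer.Base
  using (ℤ; +_; -[1+_]; 0ℤ; ∣_∣; _+_; _-_; _*_; -_; _^_)
import Data.Integer.Base as ℤ
open import Data.Integer.Divisibility using (_∣_)
open import Data.Rational.Base as ℚ using (ℚ; mkℚ; _÷_)
open import Data.Product.Base using (Σ-syntax; ∃-syntax)
open import Relation.Binary.PropositionalEquality.Core using (_≡_; _≢_)
open import Relation.Nullary.Decidable.Core using (yes; no)
open import Relation.Nullary.Negation.Core using (¬_)
open import Relation.Nullary.Construct.Add.Supremum using (_⁺; ⊤⁺; [_])
open import Relation.Binary.Construct.Add.Supremum.NonStrict ℤ._≤_ using (_≤⁺_)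
open import Relation.Binary.Construct.Add.Supremum.Strict ℤ._<_ using (_<⁺_)

fromℤ : ℤ → ℚ
fromℤ z = mkℚ z 0 (coprime-sym (1-coprimeTo ∣ z ∣))

-- The largest k ≤ bound such that p ^ k divides n.
maxExponent : (p n bound : ℕ) → ℕ
maxExponent p n zero = zero
maxExponent p n (suc k) with (p ℕ.^ suc k) ℕ.∣? n
... | yes _ = suc k
... | no  _ = maxExponent p n k

-- For p ≥ 2 and n ≥ 1, p ^ k ∣ n forces k < n, so n is a sufficient bound.
exponent : (p n : ℕ) → ℕ
exponent p n = maxExponent p n n

-- The p-adic valuation on ℚ with values in ℤ ∪ {∞}, where ν p 0 = ∞.
-- The arguments of mkℚ are the numerator and the predecessor of the
-- denominator of the reduced fraction.
ν : ℕ → ℚ → ℤ ⁺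
ν p (mkℚ (+ zero)  _ _) = ⊤⁺
ν p (mkℚ n@(+ suc _)  d _) = [ + exponent p ∣ n ∣ - + exponent p (suc d) ]
ν p (mkℚ n@(-[1+ _ ]) d _) = [ + exponent p ∣ n ∣ - + exponent p (suc d) ]

Positive : ℤ ⁺ → Set
Positive v = [ 0ℤ ] <⁺ v

-- |x - y|_p ≤ p^(-k)
Close : (p k : ℕ) → ℚ → ℚ → Set
Close p k x y = [ + k ] ≤⁺ ν p (x ℚ.- y)

-- ℚ_p as the completion of ℚ for the p-adic absolute value: its elements are
-- represented by p-adic Cauchy sequences of rationals.  Sequences with the
-- same limit are not identified; Ball below does not distinguish them.
record ℚₚ (p : ℕ) : Set where
  field
    seq    : ℕ → ℚ
    cauchy : ∀ k → ∃[ N ] (∀ m n → N ℕ.≤ m → N ℕ.≤ n → Close p k (seq m) (seq n))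

open ℚₚ public

-- The rational r satisfies |x - r|_p ≤ p^(-k).  Closed balls are open and the
-- values of |x_n - r|_p are eventually constant or tend to 0, so the bound
-- for the limit is equivalent to the bound for all large n.
Ball : ∀ {p} → ℚₚ p → ℕ → ℚ → Set
Ball {p} x k r = ∃[ N ] (∀ n → N ℕ.≤ n → Close p k (seq x n) r)

DenseInℚₚ : ℕ → (ℚ → Set) → Set
DenseInℚₚ p S = ∀ (x : ℚₚ p) (k : ℕ) → ∃[ r ] Σ[ _ ∈ S r ] Ball x k r

quartic : (a b c d e : ℤ) → ℤ → ℤ → ℤ
quartic a b c d e x y =
  a * x ^ 4 + b * x ^ 3 * y + c * x ^ 2 * y ^ 2 + d * x * y ^ 3 + e * y ^ 4

R : (ℤ → ℤ → ℤ) → ℚ → Set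
R F r = ∃[ x₁ ] ∃[ y₁ ] ∃[ x₂ ] ∃[ y₂ ]
  Σ[ F₂≢0 ∈ F x₂ y₂ ≢ 0ℤ ]
    r ≡ (fromℤ (F x₁ y₁) ÷ fromℤ (F x₂ y₂)) {{ℤ.≢-nonZero F₂≢0}}

infix 4 _≡_mod_

_≡_mod_ : ℤ → ℤ → ℕ → Set
x ≡ y mod m = + m ∣ (x - y)

-- 0 is a cube, so a non-residue is automatically nonzero modulo m.
CubicNonResidue : ℕ → ℤ → Set
CubicNonResidue m n = ¬ (∃[ t ] (t ^ 3 ≡ n mod m))

s : (a c d e : ℤ) → ℕ → ℤ
s a c d e 0 = + 3
s a c d e 1 = - (+ 2) * a * c
s a c d e 2 = + 2 * a ^ 2 * c ^ 2 + + 8 * a ^ 3 * e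
s a c d e (suc (suc (suc n))) =
    - (+ 2) * a * c * s a c d e (suc (suc n))
  + (+ 4 * a ^ 3 * e - a ^ 2 * c ^ 2) * s a c d e (suc n)
  + a ^ 4 * d ^ 2 * s a c d e n

{-# OPTIONS --safe #-}
module Submission where

open import Defs
open import Data.Nat.Base as ℕ using (ℕ; zero; suc)
open import Data.Nat.Primality using (Prime; euclidsLemma; prime⇒irreducible; prime⇒nonTrivial)
open import Data.Integer.Base as ℤ hiding (suc; Positive)
open import Data.Product.Base using (_×_; _,_; ∃-syntax; proj₁; proj₂; Σ-syntax)
open import Data.Sum.Base as Sum using (_⊎_; inj₁; inj₂; [_,_]′)
open import Relation.Binary.PropositionalEquality
open import Relation.Nullary using (¬_; yes; no)
open import Algebra.Bundles using (CommutativeSemiring)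
import Algebra.Properties.CommutativeMonoid.Mult as CommutativeMonoidMult
import Algebra.Properties.CommutativeSemiring.Binomial as Binomial
import Algebra.Properties.Semiring.Exp as Exp
import Algebra.Properties.Semiring.Mult as Mult
import Algebra.Properties.Semiring.Sum as Sum⁺
import Algebra.Structures.Biased as Biased
open import Data.Bool.Base using (T)
open import Data.Empty using (⊥; ⊥-elim)
open import Data.Fin.Base as Fin using (Fin; toℕ; fromℕ; fromℕ<; inject₁; join; splitAt; combine; remQuot)
import Data.Fin.Properties as Fin
open import Data.Integer.DivMod using (_%ℕ_; _/ℕ_; a≡a%ℕn+[a/ℕn]*n; n%ℕd<d)
open import Data.Integer.Divisibility.Signed
import Data.Integer.Properties as ℤ
open import Data.Integer.Solver using (module +-*-Solver)
open +-*-Solver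
  using (Polynomial; ⟦_⟧; normalise; correct; ⟦_⟧N-cong; _≟N_; var; con; _:+_; _:*_; _:-_; :-_; _:^_)
open import Data.Maybe.Base using (just; is-just)
open import Data.Nat.Combinatorics using (_C_; nC1≡n; nCn≡1; nCk+nC[k+1]≡[n+1]C[k+1])
open import Data.Nat.Combinatorics.Specification using (k>n⇒nCk≡0)
open import Data.Nat.Coprimality as Coprimality using (Coprime; coprime-Bézout)
import Data.Nat.DivMod as ℕ
import Data.Nat.Divisibility as ℕ
open import Data.Nat.GCD using (module Bézout)
import Data.Nat.Properties as ℕ
open import Data.Rational.Base as ℚ using (ℚ; mkℚ; ↥_; ↧_)
import Data.Rational.Properties as ℚ
open import Data.Rational.Unnormalised.Base using (*≡*)
import Data.Rational.Unnormalised.Properties as ℚᵘ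
open import Data.Vec.Base as Vec using ()
open import Data.Vec.N-ary using (N-ary; Eq; curryⁿ; _$ⁿ_; curryⁿ-cong)
open import Function.Base using (_∘_; id)
open import Level using (0ℓ)
open import Relation.Binary.Construct.Add.Supremum.NonStrict ℤ._≤_ using (_≤⁺_; [_]; _≤⊤⁺)
open import Relation.Binary.Construct.Add.Supremum.Strict ℤ._<_ using ([_])
open import Relation.Nullary.Construct.Add.Supremum using ([_])

-- Write q = ac, r = a²d, σ = a³e.  Since p divides b, a³F(x, 1) is congruent to
-- the depressed quartic y⁴ + qy² + ry + σ at y = ax, with resolvent cubic
-- g(t) = t³ + 2qt² + (q² - 4σ)t - r².
--
-- Both hypotheses imply that g has no root mod p.  In (1) this is
-- 27 g(t) = (3t + 2q)³ - (8q³ + 27r²) - 9t(q² + 12σ).  In (2), s n is the n-th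
-- power sum of the roots of g.  If g = (t - α)(t² - βt + γ), Frobenius shows that
-- s (p + 1) is α² + β² - 2γ if the quadratic factor splits and α² + 2γ if not.
-- The congruence for s (p + 1) then gives q² + 12σ ≡ 0 in the first case, and
-- makes α a root of the irreducible quadratic factor in the second.
--
-- The roots of the quartic are the base points of the pencil of conics
-- x² + qx + ry + σ = λ (y² - x), whose member λ is singular iff g(λ) = 0.  If g has
-- no root, all members are smooth, and counting their points gives a root.  It is
-- a simple root, because a double root y of the quartic yields the root 4y² of g.
-- By Hensel's lemma F(x, 1) takes values arbitrarily close to every element of pℤ,
-- in particular to pu and pv, so every fraction u/v is a limit of values in R(F).

-- Arithmetic modulo a prime

_:=_ : ∀ {n} → Polynomial n → Polynomial n → Polynomial n × Polynomial n
_:=_ = _,_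

infix 5 _:=_

-- The library's solve compares normal forms under an open environment, where
-- unfolding integer multiplication is exponential; here their syntax is compared.
solve : ∀ n (f : N-ary n (Polynomial n) (Polynomial n × Polynomial n)) →
        let e = f $ⁿ Vec.map var (Vec.allFin n) in
        {T (is-just (normalise (proj₁ e) ≟N normalise (proj₂ e)))} →
        Eq n _≡_ (curryⁿ ⟦ proj₁ e ⟧) (curryⁿ ⟦ proj₂ e ⟧)
solve n f {same} = curryⁿ-cong _≡_ ⟦ proj₁ e ⟧ ⟦ proj₂ e ⟧ λ ρ → go ρ (normalise (proj₁ e) ≟N normalise (proj₂ e)) same
  where
  e = f $ⁿ Vec.map var (Vec.allFin n)
  go : ∀ ρ m → T (is-just m) → ⟦ proj₁ e ⟧ ρ ≡ ⟦ proj₂ e ⟧ ρ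
  go ρ (just eq) _ = trans (sym (correct (proj₁ e) ρ)) (trans (⟦ eq ⟧N-cong ρ) (correct (proj₂ e) ρ))

∣-resp-≡ : ∀ {m x y} → x ≡ y → m ∣ y → m ∣ x
∣-resp-≡ refl h = h

∣-lin₂ : ∀ {m x y} u v → m ∣ x → m ∣ y → m ∣ u * x + v * y
∣-lin₂ u v h k = ∣m∣n⇒∣m+n (∣n⇒∣m*n u h) (∣n⇒∣m*n v k)

∣-lin₃ : ∀ {m x y z} u v w → m ∣ x → m ∣ y → m ∣ z → m ∣ u * x + v * y + w * z
∣-lin₃ u v w h k l = ∣m∣n⇒∣m+n (∣-lin₂ u v h k) (∣n⇒∣m*n w l)

-- Both point counts below run over a disjoint union of two families; `splitAt` carries the
-- pigeonhole principle for `Fin (a + b)` over to it.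
pigeonhole-⊎ : ∀ {a b c} → c ℕ.< a ℕ.+ b → (f : Fin a ⊎ Fin b → Fin c) →
               ∃[ x ] ∃[ y ] x ≢ y × f x ≡ f y
pigeonhole-⊎ {a} {b} c<a+b f
  with i , j , i<j , eq ← Fin.pigeonhole c<a+b (f ∘ splitAt a)
  = splitAt a i , splitAt a j , i≢j , eq
  where
  i≢j : splitAt a i ≢ splitAt a j
  i≢j eq′ = ℕ.<⇒≢ i<j (cong toℕ (trans (sym (Fin.join-splitAt a b i))
                        (trans (cong (join a b) eq′) (Fin.join-splitAt a b j))))

-- The difference has absolute value below p, and the only multiple of p that small is 0.
toℕ-unique-mod : ∀ {p a b} → a ℕ.< p → b ℕ.< p → + p ∣ + a - + b → a ≡ b
toℕ-unique-mod {p} {a} {b} a<p b<p h = ℤ.+-injective (ℤ.i-j≡0⇒i≡j (+ a) (+ b) (small _ bound (∣⇒∣ᵤ h)))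
  where
  bound : ∣ + a - + b ∣ ℕ.< p
  bound = subst (λ z → ∣ z ∣ ℕ.< p) (sym (ℤ.m-n≡m⊖n a b))
            (ℕ.≤-<-trans (ℤ.∣m⊝n∣≤m⊔n a b) (ℕ.⊔-lub a<p b<p))
  small : ∀ z → ∣ z ∣ ℕ.< p → p ℕ.∣ ∣ z ∣ → z ≡ 0ℤ
  small (+ zero) _ _ = refl
  small (+ suc _) z<p d = ⊥-elim (ℕ.>⇒∤ z<p d)
  small -[1+ _ ] z<p d = ⊥-elim (ℕ.>⇒∤ z<p d)

abs≡±1* : ∀ x → ∃[ σ ] + ∣ x ∣ ≡ σ * x
abs≡±1* (+ k)    = 1ℤ , sym (ℤ.*-identityˡ (+ k))
abs≡±1* -[1+ k ] = -1ℤ , sym (ℤ.-1*i≡-i -[1+ k ])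

-- With the prime written as `suc n`, `Fin p` enumerates the residues and `Fin n`, through
-- `suc ∘ toℕ`, the nonzero ones.
module PrimeModulus {n : ℕ} (p-prime : Prime (suc n)) where

  p : ℕ
  p = suc n

  P : ℤ
  P = + p

  euclid : ∀ x y → P ∣ x * y → (P ∣ x) ⊎ (P ∣ y)
  euclid x y h = Sum.map ∣ᵤ⇒∣ ∣ᵤ⇒∣
    (euclidsLemma ∣ x ∣ ∣ y ∣ p-prime (subst (p ℕ.∣_) (ℤ.abs-* x y) (∣⇒∣ᵤ h)))

  ∤-* : ∀ {x y} → ¬ P ∣ x → ¬ P ∣ y → ¬ P ∣ x * y
  ∤-* {x} {y} hx hy h = [ hx , hy ]′ (euclid x y h)

  ∤-cancelˡ : ∀ {x y} → ¬ P ∣ x → P ∣ x * y → P ∣ y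
  ∤-cancelˡ {x} {y} hx h = [ ⊥-elim ∘ hx , (λ z → z) ]′ (euclid x y h)

  1<p : 1 ℕ.< p
  1<p = ℕ.nonTrivial⇒n>1 p {{prime⇒nonTrivial p-prime}}

  ∤-small : ∀ {k} .{{_ : ℕ.NonZero k}} → k ℕ.< p → ¬ P ∣ + k
  ∤-small k<p h = ℕ.>⇒∤ k<p (∣⇒∣ᵤ h)

  ∤⇒coprime : ∀ {x} → ¬ P ∣ x → Coprime ∣ x ∣ p
  ∤⇒coprime {x} hx (d∣x , d∣p) with prime⇒irreducible p-prime d∣p
  ... | inj₁ d≡1 = d≡1
  ... | inj₂ refl = ⊥-elim (hx (∣ᵤ⇒∣ d∣x))

  abstract
    -- Bézout for |x| and p, where the sign `σ` with |x| = σx is absorbed into the coefficient. The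
    -- two clauses are the two forms of a Bézout identity over ℕ.
    inverse : ∀ x → ¬ P ∣ x → ∃[ y ] P ∣ x * y - 1ℤ
    inverse x hx with abs≡±1* x | coprime-Bézout (∤⇒coprime hx)
    ... | σ , |x|≡σx | Bézout.+- u v eq = σ * + u , divides (+ v) (trans
      (solve 3 (λ x σ u → x :* (σ :* u) :- con 1ℤ := u :* (σ :* x) :- con 1ℤ) x σ (+ u))
      (trans (cong (λ z → + u * z - 1ℤ) (sym |x|≡σx))
      (trans (cong (_- 1ℤ) (trans (sym (ℤ.pos-* u ∣ x ∣)) (trans (cong +_ (sym eq)) (cong (λ z → 1ℤ + z) (ℤ.pos-* v p)))))
        (solve 1 (λ z → con 1ℤ :+ z :- con 1ℤ := z) (+ v * P)))))
    ... | σ , |x|≡σx | Bézout.-+ u v eq = - (σ * + u) , divides (- + v) (trans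
      (solve 3 (λ x σ u → x :* (:- (σ :* u)) :- con 1ℤ := :- (con 1ℤ :+ u :* (σ :* x))) x σ (+ u))
      (trans (cong (λ z → - (1ℤ + + u * z)) (sym |x|≡σx))
      (trans (cong -_ (trans (cong (λ z → 1ℤ + z) (sym (ℤ.pos-* u ∣ x ∣))) (trans (cong +_ eq) (ℤ.pos-* v p))))
        (ℤ.neg-distribˡ-* (+ v) P))))

    residue : ℤ → Fin p
    residue x = fromℕ< (n%ℕd<d x p)

    residue-∣ : ∀ x → P ∣ x - + toℕ (residue x)
    residue-∣ x = subst (λ k → P ∣ x - + k) (sym (Fin.toℕ-fromℕ< (n%ℕd<d x p)))
      (divides (x /ℕ p) (trans (cong (_- + (x %ℕ p)) (a≡a%ℕn+[a/ℕn]*n x p))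
         (solve 2 (λ a b → a :+ b :- a := b) (+ (x %ℕ p)) ((x /ℕ p) * P))))

  residue-injective : ∀ x y → residue x ≡ residue y → P ∣ x - y
  residue-injective x y eq = ∣-resp-≡
    (solve 3 (λ x y i → x :- y := con 1ℤ :* (x :- i) :+ con -1ℤ :* (y :- i)) x y (+ toℕ (residue x)))
    (∣-lin₂ 1ℤ -1ℤ (residue-∣ x) (subst (λ i → P ∣ y - + toℕ i) (sym eq) (residue-∣ y)))

  unitResidue : ∀ x → ¬ P ∣ x → ∃[ i ] P ∣ x - + suc (toℕ {n} i)
  unitResidue x hx with residue x | residue-∣ x
  ... | Fin.zero  | h = ⊥-elim (hx (∣-resp-≡ (sym (ℤ.+-identityʳ x)) h))
  ... | Fin.suc i | h = i , h

  2∤ : 2 ℕ.< p → ¬ P ∣ + 2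
  2∤ = ∤-small

  lift-∣ : ∀ m {x} → P ∣ x → P * m ∣ m * x
  lift-∣ m {x} h = subst (_∣ m * x) (ℤ.*-comm m P) (*-monoʳ-∣ m h)

  suc-toℕ-unit : (i : Fin n) → ¬ P ∣ + suc (toℕ i)
  suc-toℕ-unit i = ∤-small (ℕ.s≤s (Fin.toℕ<n i))

  odd : 2 ℕ.< p → ∃[ h ] p ≡ suc (h ℕ.+ h)
  odd 2<p with p ℕ.% 2 | ℕ.m≡m%n+[m/n]*n p 2 | ℕ.m%n<n p 2
  ... | 0 | eq | _ with prime⇒irreducible p-prime (ℕ.divides (p ℕ./ 2) eq)
  ...   | inj₂ 2≡p = ⊥-elim (ℕ.<⇒≢ 2<p 2≡p)
  odd 2<p | 1 | eq | _ = p ℕ./ 2 , trans eq (cong suc (trans (ℕ.*-comm (p ℕ./ 2) 2) (cong (p ℕ./ 2 ℕ.+_) (ℕ.+-identityʳ _))))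
  odd 2<p | suc (suc _) | _ | ℕ.s≤s (ℕ.s≤s ())

-- Points of the conics u² - dv² = m

module Conics {n : ℕ} (p-prime : Prime (suc n)) (2<p : 2 ℕ.< suc n) where
  open PrimeModulus p-prime

  toℕ-injective-mod : (i j : Fin p) → P ∣ + toℕ i - + toℕ j → i ≡ j
  toℕ-injective-mod i j h = Fin.toℕ-injective (toℕ-unique-mod (Fin.toℕ<n i) (Fin.toℕ<n j) h)

  suc-toℕ-injective-mod : (i j : Fin n) → P ∣ + suc (toℕ i) - + suc (toℕ j) → i ≡ j
  suc-toℕ-injective-mod i j h = Fin.suc-injective (toℕ-injective-mod (Fin.suc i) (Fin.suc j) h)

  norm : ℤ → ℤ × ℤ → ℤ
  norm d (u , v) = u * u - d * (v * v)

  DistinctMod : ∀ {k} → (Fin k → ℤ × ℤ) → Set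
  DistinctMod pt = ∀ i j → P ∣ proj₁ (pt i) - proj₁ (pt j) → P ∣ proj₂ (pt i) - proj₂ (pt j) → i ≡ j

  -- If d = μ², the points are given by u - μv = k, u + μv = m/k with k a unit.
  hyperbola-points : ∀ d m μ → ¬ P ∣ d → P ∣ μ * μ - d →
    Σ[ pt ∈ (Fin n → ℤ × ℤ) ] (∀ i → P ∣ norm d (pt i) - m) × DistinctMod pt
  hyperbola-points d m μ d∤ μ²≋d
    -- `μ` is a unit because its square is congruent to the unit `d`; `h` is one half.
    with μ′ , μμ′ ← inverse μ (λ h → d∤ (∣-resp-≡
           (solve 2 (λ d μ → d := μ :* μ :+ con -1ℤ :* (μ :* μ :- d)) d μ) (∣-lin₂ μ -1ℤ h μ²≋d)))
       | h , 2h ← inverse (+ 2) (2∤ 2<p)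
    = (λ i → u i , v i) , onConic , distinct
    where
    k k′ u v : Fin n → ℤ
    k i = + suc (toℕ i)
    k′ i = proj₁ (inverse (k i) (suc-toℕ-unit i))
    u i = h * (k i + m * k′ i)
    v i = h * μ′ * (m * k′ i - k i)
    kk′ : ∀ i → P ∣ k i * k′ i - 1ℤ
    kk′ i = proj₂ (inverse (k i) (suc-toℕ-unit i))
    u-μv : ∀ i → P ∣ u i - μ * v i - k i
    u-μv i = ∣-resp-≡
      (solve 6 (λ μ μ′ h k k′ m → h :* (k :+ m :* k′) :- μ :* (h :* μ′ :* (m :* k′ :- k)) :- k
         := k :* (con (+ 2) :* h :- con 1ℤ) :+ (:- (h :* (m :* k′ :- k))) :* (μ :* μ′ :- con 1ℤ))
         μ μ′ h (k i) (k′ i) m)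
      (∣-lin₂ (k i) (- (h * (m * k′ i - k i))) 2h μμ′)
    u+μv : ∀ i → P ∣ u i + μ * v i - m * k′ i
    u+μv i = ∣-resp-≡
      (solve 6 (λ μ μ′ h k k′ m → h :* (k :+ m :* k′) :+ μ :* (h :* μ′ :* (m :* k′ :- k)) :- m :* k′
         := (m :* k′) :* (con (+ 2) :* h :- con 1ℤ) :+ (h :* (m :* k′ :- k)) :* (μ :* μ′ :- con 1ℤ))
         μ μ′ h (k i) (k′ i) m)
      (∣-lin₂ (m * k′ i) (h * (m * k′ i - k i)) 2h μμ′)
    onConic : ∀ i → P ∣ norm d (u i , v i) - m
    onConic i = ∣-resp-≡
      (solve 7 (λ u v k k′ m μ d → u :* u :- d :* (v :* v) :- m
         := con 1ℤ :* ((u :+ μ :* v) :* (u :- μ :* v :- k) :+ k :* (u :+ μ :* v :- m :* k′))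
            :+ con 1ℤ :* (m :* (k :* k′ :- con 1ℤ) :+ (v :* v) :* (μ :* μ :- d)))
         (u i) (v i) (k i) (k′ i) m μ d)
      (∣-lin₂ 1ℤ 1ℤ (∣-lin₂ (u i + μ * v i) (k i) (u-μv i) (u+μv i)) (∣-lin₂ m (v i * v i) (kk′ i) μ²≋d))
    -- The parameter is recovered from the point as k = u - μv.
    distinct : DistinctMod (λ i → u i , v i)
    distinct i j hu hv = suc-toℕ-injective-mod i j (∣-resp-≡
      (solve 7 (λ u v k u₁ v₁ k₁ μ → k :- k₁
         := con 1ℤ :* (con 1ℤ :* (u :- u₁) :+ (:- μ) :* (v :- v₁))
            :+ con 1ℤ :* (con -1ℤ :* (u :- μ :* v :- k) :+ con 1ℤ :* (u₁ :- μ :* v₁ :- k₁)))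
         (u i) (v i) (k i) (u j) (v j) (k j) μ)
      (∣-lin₂ 1ℤ 1ℤ (∣-lin₂ 1ℤ (- μ) hu hv) (∣-lin₂ -1ℤ 1ℤ (u-μv i) (u-μv j))))

  squares-mod : ∀ x y → P ∣ x * x - y * y → (P ∣ x - y) ⊎ (P ∣ x + y)
  squares-mod x y h = euclid (x - y) (x + y)
    (∣-resp-≡ (solve 2 (λ x y → (x :- y) :* (x :+ y) := x :* x :- y :* y) x y) h)

  -- If i² ≡ j², then i ≡ j or i + j ≡ 0. Since i + j ≤ 2h < p, the second case forces i = j = 0.
  squares-distinct : ∀ h → p ≡ suc (h ℕ.+ h) → (i j : Fin (suc h)) →
    P ∣ + toℕ i * + toℕ i - + toℕ j * + toℕ j → i ≡ j
  squares-distinct h p≡ i j hyp = Fin.toℕ-injective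
    ([ toℕ-unique-mod (bound i) (bound j) , both-zero ]′ (squares-mod (+ toℕ i) (+ toℕ j) hyp))
    where
    bound : (i : Fin (suc h)) → toℕ i ℕ.< p
    bound i = ℕ.≤-trans (Fin.toℕ<n i) (subst (suc h ℕ.≤_) (sym p≡) (ℕ.s≤s (ℕ.m≤m+n h h)))
    sum<p : toℕ i ℕ.+ toℕ j ℕ.< p
    sum<p = subst (suc (toℕ i ℕ.+ toℕ j) ℕ.≤_) (sym p≡) (ℕ.s≤s (ℕ.+-mono-≤ (Fin.toℕ≤pred[n] i) (Fin.toℕ≤pred[n] j)))
    both-zero : P ∣ + (toℕ i ℕ.+ toℕ j) → toℕ i ≡ toℕ j
    both-zero d = trans (ℕ.m+n≡0⇒m≡0 (toℕ i) sum≡0) (sym (ℕ.m+n≡0⇒n≡0 (toℕ i) sum≡0))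
      where
      sum≡0 : toℕ i ℕ.+ toℕ j ≡ 0
      sum≡0 = toℕ-unique-mod sum<p (ℕ.s≤s ℕ.z≤n)
        (subst (P ∣_) (sym (ℤ.+-identityʳ (+ (toℕ i ℕ.+ toℕ j)))) d)

  -- For 0 ≤ i ≤ (p - 1)/2 the values i² are distinct mod p, and so are the values m + di². These
  -- are p + 1 values in all, so one of the first kind meets one of the second.
  norm-point : ∀ d m → ¬ P ∣ d → ∃[ u ] ∃[ v ] P ∣ norm d (u , v) - m
  norm-point d m d∤ with h , p≡ ← odd 2<p = fromCollision (pigeonhole-⊎ 1+2h<2[1+h] f)
    where
    f : Fin (suc h) ⊎ Fin (suc h) → Fin p
    f (inj₁ i) = residue (+ toℕ i * + toℕ i)
    f (inj₂ i) = residue (m + d * (+ toℕ i * + toℕ i))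
    1+2h<2[1+h] : p ℕ.< suc h ℕ.+ suc h
    1+2h<2[1+h] = subst (ℕ._≤ suc h ℕ.+ suc h) (cong suc (trans (ℕ.+-suc h h) (sym p≡))) ℕ.≤-refl
    norm-difference : ∀ u v → P ∣ u * u - (m + d * (v * v)) → P ∣ norm d (u , v) - m
    norm-difference u v = ∣-resp-≡
      (solve 4 (λ d m u v → u :* u :- d :* (v :* v) :- m := u :* u :- (m :+ d :* (v :* v))) d m u v)
    factor-d : ∀ x y → P ∣ m + d * x - (m + d * y) → P ∣ d * (x - y)
    factor-d x y = ∣-resp-≡
      (solve 4 (λ d m x y → d :* (x :- y) := m :+ d :* x :- (m :+ d :* y)) d m x y)
    mixed : ∀ i j → f (inj₁ i) ≡ f (inj₂ j) → ∃[ u ] ∃[ v ] P ∣ norm d (u , v) - m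
    mixed i j eq = + toℕ i , + toℕ j , norm-difference (+ toℕ i) (+ toℕ j) (residue-injective (+ toℕ i * + toℕ i) (m + d * (+ toℕ j * + toℕ j)) eq)
    fromCollision : ∃[ x ] ∃[ y ] x ≢ y × f x ≡ f y → ∃[ u ] ∃[ v ] P ∣ norm d (u , v) - m
    fromCollision (inj₁ i , inj₁ j , i≢j , eq) =
      ⊥-elim (i≢j (cong inj₁ (squares-distinct h p≡ i j (residue-injective (+ toℕ i * + toℕ i) (+ toℕ j * + toℕ j) eq))))
    fromCollision (inj₁ i , inj₂ j , _ , eq) = mixed i j eq
    fromCollision (inj₂ i , inj₁ j , _ , eq) = mixed j i (sym eq)
    fromCollision (inj₂ i , inj₂ j , i≢j , eq) =
      ⊥-elim (i≢j (cong inj₂ (squares-distinct h p≡ i j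
        (∤-cancelˡ d∤ (factor-d (+ toℕ i * + toℕ i) (+ toℕ j * + toℕ j)
          (residue-injective (m + d * (+ toℕ i * + toℕ i)) (m + d * (+ toℕ j * + toℕ j)) eq))))))

  -- The second intersection of the conic with the line of slope t through one
  -- of its points (u₀ , v₀) is (u₀ + t w , v₀ + w), with w as in Step.
  module Chords (d m : ℤ) (d∤ : ¬ P ∣ d) (m∤ : ¬ P ∣ m) (u₀ v₀ : ℤ) (base : P ∣ norm d (u₀ , v₀) - m) where

    Step : ℤ → ℤ → Set
    Step t w = P ∣ (t * t - d) * w - + 2 * (d * v₀ - u₀ * t)

    step : ∀ t → ¬ P ∣ t * t - d → ∃[ w ] Step t w
    step t t²≄d with c , inv ← inverse (t * t - d) t²≄d
      = + 2 * (d * v₀ - u₀ * t) * c , ∣-resp-≡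
      (solve 3 (λ s b c → s :* (b :* c) :- b := b :* (s :* c :- con 1ℤ)) (t * t - d) (+ 2 * (d * v₀ - u₀ * t)) c)
      (∣n⇒∣m*n (+ 2 * (d * v₀ - u₀ * t)) inv)

    second-point : ∀ t w → Step t w → P ∣ norm d (u₀ + t * w , v₀ + w) - m
    second-point t w st = ∣-resp-≡
      (solve 6 (λ d m u₀ v₀ t w → (u₀ :+ t :* w) :* (u₀ :+ t :* w) :- d :* ((v₀ :+ w) :* (v₀ :+ w)) :- m
         := con 1ℤ :* (u₀ :* u₀ :- d :* (v₀ :* v₀) :- m) :+ w :* ((t :* t :- d) :* w :- con (+ 2) :* (d :* v₀ :- u₀ :* t)))
         d m u₀ v₀ t w)
      (∣-lin₂ 1ℤ w base st)

    -- If w ≡ 0, the second intersection is the base point again, so the line is the tangent there.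
    tangent : ∀ t w → Step t w → P ∣ w → P ∣ d * v₀ - u₀ * t
    tangent t w st hw = ∤-cancelˡ (2∤ 2<p) (∣-resp-≡
      (solve 3 (λ a s w → a := s :* w :+ con -1ℤ :* (s :* w :- a)) (+ 2 * (d * v₀ - u₀ * t)) (t * t - d) w)
      (∣-lin₂ (t * t - d) -1ℤ hw st))

    -- With u₀ ≡ 0 the tangent equation gives v₀ ≡ 0, and the base point would then give m ≡ 0.
    u₀∤ : ∀ t → P ∣ d * v₀ - u₀ * t → ¬ P ∣ u₀
    u₀∤ t tan hu₀ = m∤ (∣-resp-≡
      (solve 4 (λ d m u v → m := con -1ℤ :* (u :* u :- d :* (v :* v) :- m) :+ u :* u :+ (:- (d :* v)) :* v) d m u₀ v₀)
      (∣-lin₃ -1ℤ u₀ (- (d * v₀)) base hu₀ hv₀))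
      where
      hv₀ : P ∣ v₀
      hv₀ = ∤-cancelˡ d∤ (∣-resp-≡
        (solve 4 (λ d v u t → d :* v := con 1ℤ :* (d :* v :- u :* t) :+ t :* u) d v₀ u₀ t)
        (∣-lin₂ 1ℤ t tan hu₀))

    -- Equal second points give w(t - t′) ≡ 0. If w ≡ 0, both lines are tangent at the base point,
    -- and the tangent slope is unique because u₀ is a unit.
    slope-unique : ∀ t t′ w w′ → Step t w → Step t′ w′ →
      P ∣ u₀ + t * w - (u₀ + t′ * w′) → P ∣ v₀ + w - (v₀ + w′) → P ∣ t - t′
    slope-unique t t′ w w′ st st′ hu hv = [ tangential , (λ t≋t′ → t≋t′) ]′ (euclid w (t - t′) (∣-resp-≡
        (solve 6 (λ u₀ v₀ t₁ t₂ w₁ w₂ → w₁ :* (t₁ :- t₂)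
            := con 1ℤ :* (u₀ :+ t₁ :* w₁ :- (u₀ :+ t₂ :* w₂)) :+ (:- t₂) :* (v₀ :+ w₁ :- (v₀ :+ w₂))) u₀ v₀ t t′ w w′)
        (∣-lin₂ 1ℤ (- t′) hu hv)))
      where
      tangential : P ∣ w → P ∣ t - t′
      tangential hw = ∤-cancelˡ (u₀∤ t (tangent t w st hw)) (∣-resp-≡
        (solve 5 (λ d v u t₁ t₂ → u :* (t₁ :- t₂) := con -1ℤ :* (d :* v :- u :* t₁) :+ con 1ℤ :* (d :* v :- u :* t₂)) d v₀ u₀ t t′)
        (∣-lin₂ -1ℤ 1ℤ (tangent t w st hw) (tangent t′ w′ st′ (∣-resp-≡
          (solve 3 (λ v a b → b := con 1ℤ :* a :+ con -1ℤ :* (v :+ a :- (v :+ b))) v₀ w w′) (∣-lin₂ 1ℤ -1ℤ hw hv)))))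

  -- For a nonsquare `d` the factor t² - d never vanishes, so each slope gives a second
  -- intersection. The slopes 0, ..., p - 2 suffice to match the number of points found on a
  -- hyperbola.
  ellipse-points : ∀ d m → ¬ P ∣ d → ¬ P ∣ m → (∀ (i : Fin p) → ¬ P ∣ + toℕ i * + toℕ i - d) →
    Σ[ pt ∈ (Fin n → ℤ × ℤ) ] (∀ i → P ∣ norm d (pt i) - m) × DistinctMod pt
  ellipse-points d m d∤ m∤ nonsquare with u₀ , v₀ , base ← norm-point d m d∤
    = (λ i → u₀ + t i * w i , v₀ + w i) , (λ i → second-point (t i) (w i) (st i)) , distinct
    where
    open Chords d m d∤ m∤ u₀ v₀ base
    t w : Fin n → ℤ
    t i = + toℕ i
    t²≄d : ∀ i → ¬ P ∣ t i * t i - d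
    t²≄d i = subst (λ k → ¬ P ∣ + k * + k - d) (Fin.toℕ-inject₁ i) (nonsquare (Fin.inject₁ i))
    w i = proj₁ (step (t i) (t²≄d i))
    st : ∀ i → Step (t i) (w i)
    st i = proj₂ (step (t i) (t²≄d i))
    distinct : DistinctMod (λ i → u₀ + t i * w i , v₀ + w i)
    distinct i j hu hv = Fin.toℕ-injective
      (toℕ-unique-mod (ℕ.m<n⇒m<1+n (Fin.toℕ<n i)) (ℕ.m<n⇒m<1+n (Fin.toℕ<n j))
        (slope-unique (t i) (t j) (w i) (w j) (st i) (st j) hu hv))

  norm-points : ∀ d m → ¬ P ∣ d → ¬ P ∣ m →
    Σ[ pt ∈ (Fin n → ℤ × ℤ) ] (∀ i → P ∣ norm d (pt i) - m) × DistinctMod pt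
  norm-points d m d∤ m∤ with Fin.any? (λ (i : Fin p) → P ∣? + toℕ i * + toℕ i - d)
  ... | yes (i , sq) = hyperbola-points d m (+ toℕ i) d∤ sq
  ... | no nonsquare = ellipse-points d m d∤ m∤ (λ i h → nonsquare (i , h))

-- The pencil of conics of a depressed quartic

resolvent : (q r σ : ℤ) → ℤ → ℤ
resolvent q r σ t = t * t * t + + 2 * q * (t * t) + (q * q - + 4 * σ) * t - r * r

depressed : (q r σ : ℤ) → ℤ → ℤ
depressed q r σ y = y * y * y * y + q * (y * y) + r * y + σ

module Pencil {n : ℕ} (p-prime : Prime (suc n)) (2<p : 2 ℕ.< suc n) (q r σ : ℤ)
  (no-root : ∀ t → ¬ + suc n ∣ resolvent q r σ t) where
  open PrimeModulus p-prime
  open Conics p-prime 2<p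

  conic : ℤ → ℤ × ℤ → ℤ
  conic d (x , y) = x * x + q * x + r * y + σ - d * (y * y - x)

  abstract
    -- Completing squares, with h = 1/2 and l = 1/d, turns the conic into u² - dv² = m. Here 4dm ≡
    -- g(d), so `m` is a unit because g has no root.
    nondegenerate-points : ∀ d → ¬ P ∣ d →
      Σ[ pt ∈ (Fin n → ℤ × ℤ) ] (∀ i → P ∣ conic d (pt i)) × DistinctMod pt
    nondegenerate-points d d∤ =
      let h , 2h = inverse (+ 2) (2∤ 2<p)
          l , dl = inverse d d∤
      in fromCentre h 2h l dl
      where
      fromCentre : ∀ h → P ∣ + 2 * h - 1ℤ → ∀ l → P ∣ d * l - 1ℤ →
        Σ[ pt ∈ (Fin n → ℤ × ℤ) ] (∀ i → P ∣ conic d (pt i)) × DistinctMod pt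
      fromCentre h 2h l dl =
        let uv , onNorm , distinct = norm-points d m d∤ m∤
        in (λ i → translate (uv i)) , (λ i → onConic (proj₁ (uv i)) (proj₂ (uv i)) (onNorm i)) ,
           (λ i j hx hy → distinct i j (cancel (proj₁ (uv i)) (proj₁ (uv j)) (h * (q + d)) hx) (cancel₊ (proj₂ (uv i)) (proj₂ (uv j)) (h * l * r) hy))
        where
        m : ℤ
        m = h * h * ((q + d) * (q + d)) - h * h * l * (r * r) - σ
        m∤ : ¬ P ∣ m
        m∤ hm = no-root d (∣-resp-≡
          (solve 6 (λ d q r σ h l →
               d :* d :* d :+ con (+ 2) :* q :* (d :* d) :+ (q :* q :- con (+ 4) :* σ) :* d :- r :* r
            := con (+ 4) :* d :* (h :* h :* ((q :+ d) :* (q :+ d)) :- h :* h :* l :* (r :* r) :- σ)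
               :+ (:- ((con (+ 2) :* h :+ con 1ℤ) :* (d :* ((q :+ d) :* (q :+ d)) :- r :* r :* (d :* l)))) :* (con (+ 2) :* h :- con 1ℤ)
               :+ (r :* r) :* (d :* l :- con 1ℤ))
            d q r σ h l)
          (∣-lin₃ (+ 4 * d) (- ((+ 2 * h + 1ℤ) * (d * ((q + d) * (q + d)) - r * r * (d * l)))) (r * r) hm 2h dl))
        translate : ℤ × ℤ → ℤ × ℤ
        translate (u , v) = u - h * (q + d) , v + h * l * r
        onConic : ∀ u v → P ∣ norm d (u , v) - m → P ∣ conic d (translate (u , v))
        onConic u v uv = ∣-resp-≡
          (solve 8 (λ d q r σ h l u v →
               (u :- h :* (q :+ d)) :* (u :- h :* (q :+ d)) :+ q :* (u :- h :* (q :+ d)) :+ r :* (v :+ h :* l :* r) :+ σ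
                 :- d :* ((v :+ h :* l :* r) :* (v :+ h :* l :* r) :- (u :- h :* (q :+ d)))
            := con 1ℤ :* (u :* u :- d :* (v :* v) :- (h :* h :* ((q :+ d) :* (q :+ d)) :- h :* h :* l :* (r :* r) :- σ))
               :+ (h :* ((q :+ d) :* (q :+ d)) :- u :* (q :+ d) :- r :* v :- h :* l :* (r :* r)) :* (con (+ 2) :* h :- con 1ℤ)
               :+ (:- (con (+ 2) :* h :* r :* v :+ h :* h :* l :* (r :* r))) :* (d :* l :- con 1ℤ))
            d q r σ h l u v)
          (∣-lin₃ 1ℤ (h * ((q + d) * (q + d)) - u * (q + d) - r * v - h * l * (r * r))
            (- (+ 2 * h * r * v + h * h * l * (r * r))) uv 2h dl)
        cancel : ∀ x y z → P ∣ x - z - (y - z) → P ∣ x - y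
        cancel x y z = ∣-resp-≡ (solve 3 (λ x y z → x :- y := x :- z :- (y :- z)) x y z)
        cancel₊ : ∀ x y z → P ∣ x + z - (y + z) → P ∣ x - y
        cancel₊ x y z = ∣-resp-≡ (solve 3 (λ x y z → x :- y := x :+ z :- (y :+ z)) x y z)

    -- The member d = 0 of the pencil is the graph of a quadratic function, as r ≢ 0.
    parabola-point : ∀ x → ∃[ y ] P ∣ conic 0ℤ (x , y)
    parabola-point x =
      let r′ , rr′ = inverse r r∤
      in - ((x * x + q * x + σ) * r′) , ∣-resp-≡
        (solve 5 (λ q r σ x r′ → x :* x :+ q :* x :+ r :* (:- ((x :* x :+ q :* x :+ σ) :* r′)) :+ σ
             :- con 0ℤ :* ((:- ((x :* x :+ q :* x :+ σ) :* r′)) :* (:- ((x :* x :+ q :* x :+ σ) :* r′)) :- x)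
           := (:- (x :* x :+ q :* x :+ σ)) :* (r :* r′ :- con 1ℤ)) q r σ x r′)
        (∣n⇒∣m*n (- (x * x + q * x + σ)) rr′)
      where
      r∤ : ¬ P ∣ r
      r∤ hr = no-root 0ℤ (∣-resp-≡
        (solve 3 (λ q r σ → con 0ℤ :* con 0ℤ :* con 0ℤ :+ con (+ 2) :* q :* (con 0ℤ :* con 0ℤ) :+ (q :* q :- con (+ 4) :* σ) :* con 0ℤ :- r :* r
          := (:- r) :* r) q r σ) (∣n⇒∣m*n (- r) hr))

  private
    -- The left summand, decoded by `remQuot`, pairs a nonzero parameter with a point of its conic.
    -- The right summand is the x-coordinate of a point of the parabola d = 0.
    Index : Set
    Index = Fin (n ℕ.* n) ⊎ Fin p

    parameter : Index → ℤ
    parameter (inj₁ k) = + suc (toℕ (proj₁ (remQuot {n} n k)))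
    parameter (inj₂ _) = 0ℤ

    unit-pts : (i : Fin n) → Σ[ pt ∈ (Fin n → ℤ × ℤ) ] (∀ j → P ∣ conic (+ suc (toℕ i)) (pt j)) × DistinctMod pt
    unit-pts i = nondegenerate-points (+ suc (toℕ i)) (suc-toℕ-unit i)

    point : Index → ℤ × ℤ
    point (inj₁ k) = proj₁ (unit-pts (proj₁ (remQuot {n} n k))) (proj₂ (remQuot {n} n k))
    point (inj₂ i) = + toℕ i , proj₁ (parabola-point (+ toℕ i))

    onConic : ∀ k → P ∣ conic (parameter k) (point k)
    onConic (inj₁ k) = proj₁ (proj₂ (unit-pts (proj₁ (remQuot {n} n k)))) (proj₂ (remQuot {n} n k))
    onConic (inj₂ i) = proj₂ (parabola-point (+ toℕ i))

    minus-0 : ∀ x → P ∣ x - 0ℤ → P ∣ x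
    minus-0 x = ∣-resp-≡ (sym (ℤ.+-identityʳ x))

    0-minus : ∀ x → P ∣ 0ℤ - x → P ∣ x
    0-minus x h = ∣-resp-≡ (solve 1 (λ x → x := con -1ℤ :* (con 0ℤ :- x)) x) (∣n⇒∣m*n -1ℤ h)

    index-unique : ∀ k l → P ∣ parameter k - parameter l →
      P ∣ proj₁ (point k) - proj₁ (point l) → P ∣ proj₂ (point k) - proj₂ (point l) → k ≡ l
    index-unique (inj₁ k) (inj₁ l) hd hx hy =
      let i , j = remQuot {n} n k ; i′ , j′ = remQuot {n} n l in
      cong inj₁ (trans (sym (Fin.combine-remQuot {n} n k))
        (trans (same i i′ j j′ (suc-toℕ-injective-mod i i′ hd) hx hy) (Fin.combine-remQuot {n} n l)))
      where
      -- The list of points depends on the conic, so the conics are identified first and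
      -- distinctness within one list is used afterwards.
      same : ∀ i i′ j j′ → i ≡ i′ →
        P ∣ proj₁ (proj₁ (unit-pts i) j) - proj₁ (proj₁ (unit-pts i′) j′) →
        P ∣ proj₂ (proj₁ (unit-pts i) j) - proj₂ (proj₁ (unit-pts i′) j′) →
        combine i j ≡ combine i′ j′
      same i _ j j′ refl hx hy = cong (combine i) (proj₂ (proj₂ (unit-pts i)) j j′ hx hy)
    index-unique (inj₁ k) (inj₂ _) hd _ _ =
      ⊥-elim (suc-toℕ-unit (proj₁ (remQuot {n} n k)) (minus-0 (+ suc (toℕ (proj₁ (remQuot {n} n k)))) hd))
    index-unique (inj₂ _) (inj₁ l) hd _ _ =
      ⊥-elim (suc-toℕ-unit (proj₁ (remQuot {n} n l)) (0-minus (+ suc (toℕ (proj₁ (remQuot {n} n l)))) hd))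
    index-unique (inj₂ i) (inj₂ j) _ hx _ = cong inj₂ (toℕ-injective-mod i j hx)

    -- Where x ≡ y², the term with `d` vanishes and the conic equation becomes the quartic in y.
    base-point : ∀ d x y → P ∣ conic d (x , y) → P ∣ x - y * y → P ∣ depressed q r σ y
    base-point d x y hc hxy = ∣-resp-≡
      (solve 6 (λ q r σ d x y → y :* y :* y :* y :+ q :* (y :* y) :+ r :* y :+ σ
         := con 1ℤ :* (x :* x :+ q :* x :+ r :* y :+ σ :- d :* (y :* y :- x))
            :+ (:- (x :+ y :* y :+ q :+ d)) :* (x :- y :* y)) q r σ d x y)
      (∣-lin₂ 1ℤ (- (x + y * y + q + d)) hc hxy)

    same-x : ∀ x y x′ y′ → P ∣ x - y * y - (x′ - y′ * y′) → P ∣ y - y′ → P ∣ x - x′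
    same-x x y x′ y′ hD hy = ∣-resp-≡
      (solve 4 (λ x y x′ y′ → x :- x′ := con 1ℤ :* (x :- y :* y :- (x′ :- y′ :* y′)) :+ (y :+ y′) :* (y :- y′)) x y x′ y′)
      (∣-lin₂ 1ℤ (y + y′) hD hy)

    -- The conic equation is linear in `d` with coefficient x - y², so off the base locus the point
    -- determines `d`.
    same-parameter : ∀ d d′ x y x′ y′ → ¬ P ∣ x - y * y → P ∣ conic d (x , y) → P ∣ conic d′ (x′ , y′) →
      P ∣ x - x′ → P ∣ y - y′ → P ∣ d - d′
    same-parameter d d′ x y x′ y′ nz hc hc′ hx hy = ∤-cancelˡ nz (∣-resp-≡
      (solve 9 (λ q r σ d d′ x y x′ y′ → (x :- y :* y) :* (d :- d′)
         := con 1ℤ :* (con 1ℤ :* (x :* x :+ q :* x :+ r :* y :+ σ :- d :* (y :* y :- x))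
                       :+ con -1ℤ :* (x′ :* x′ :+ q :* x′ :+ r :* y′ :+ σ :- d′ :* (y′ :* y′ :- x′)))
            :+ con 1ℤ :* ((:- (x :+ x′ :+ q :+ d′)) :* (x :- x′) :+ (d′ :* (y :+ y′) :- r) :* (y :- y′)))
        q r σ d d′ x y x′ y′)
      (∣-lin₂ 1ℤ 1ℤ (∣-lin₂ 1ℤ -1ℤ hc hc′) (∣-lin₂ (- (x + x′ + q + d′)) (d′ * (y + y′) - r) hx hy)))

  -- A point off the base locus lies on one conic of the pencil only. There are
  -- p (p - 1) points (x , y) with x ≢ y², but without base points the
  -- members with finite d contain at least (p - 1)² + p of them.
  ¬¬root : ¬ (∀ y → ¬ P ∣ depressed q r σ y)
  ¬¬root rootless =
    let k , l , k≢l , eq = pigeonhole-⊎ {n ℕ.* n} {p} {n ℕ.* p} count f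
    in k≢l (f-injective k l eq)
    where
    x y : Index → ℤ
    x k = proj₁ (point k)
    y k = proj₂ (point k)
    nz : ∀ k → ¬ P ∣ x k - y k * y k
    nz k h = rootless (y k) (base-point (parameter k) (x k) (y k) (onConic k) h)
    u : ∀ k → ∃[ i ] P ∣ x k - y k * y k - + suc (toℕ {n} i)
    u k = unitResidue (x k - y k * y k) (nz k)
    -- A point is recorded by the nonzero residue of x - y² and the residue of y, which together
    -- determine x.
    f : Index → Fin (n ℕ.* p)
    f k = combine (proj₁ (u k)) (residue (y k))
    -- With p = n + 1, the target has n² + n elements, one fewer than the source.
    count : n ℕ.* p ℕ.< n ℕ.* n ℕ.+ p
    count = subst (ℕ._< n ℕ.* n ℕ.+ p) (trans (ℕ.+-comm (n ℕ.* n) n) (sym (ℕ.*-suc n n)))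
      (ℕ.+-monoʳ-< (n ℕ.* n) (ℕ.n<1+n n))
    f-injective : ∀ k l → f k ≡ f l → k ≡ l
    f-injective k l eq = index-unique k l
      (same-parameter (parameter k) (parameter l) (x k) (y k) (x l) (y l) (nz k) (onConic k) (onConic l) hx hy) hx hy
      where
      eqs : proj₁ (u k) ≡ proj₁ (u l) × residue (y k) ≡ residue (y l)
      eqs = Fin.combine-injective (proj₁ (u k)) (residue (y k)) (proj₁ (u l)) (residue (y l)) eq
      hy : P ∣ y k - y l
      hy = residue-injective (y k) (y l) (proj₂ eqs)
      difference : ∀ a b c → P ∣ a - c → P ∣ b - c → P ∣ a - b
      difference a b c ha hb = ∣-resp-≡ (solve 3 (λ a b c → a :- b := con 1ℤ :* (a :- c) :+ con -1ℤ :* (b :- c)) a b c) (∣-lin₂ 1ℤ -1ℤ ha hb)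
      hx : P ∣ x k - x l
      hx = same-x (x k) (y k) (x l) (y l)
        (difference (x k - y k * y k) (x l - y l * y l) (+ suc (toℕ (proj₁ (u k)))) (proj₂ (u k))
          (subst (λ i → P ∣ x l - y l * y l - + suc (toℕ i)) (sym (proj₁ eqs)) (proj₂ (u l)))) hy

  depressed-cong : ∀ y z → P ∣ y - z → P ∣ depressed q r σ y → P ∣ depressed q r σ z
  depressed-cong y z hyz hy = ∣-resp-≡
    (solve 5 (λ q r σ y z → z :* z :* z :* z :+ q :* (z :* z) :+ r :* z :+ σ
      := con 1ℤ :* (y :* y :* y :* y :+ q :* (y :* y) :+ r :* y :+ σ)
         :+ (:- ((y :+ z) :* (y :* y :+ z :* z) :+ q :* (y :+ z) :+ r)) :* (y :- z)) q r σ y z)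
    (∣-lin₂ 1ℤ (- ((y + z) * (y * y + z * z) + q * (y + z) + r)) hy hyz)

  -- Searching the finitely many residues decides whether a root exists, which turns `¬¬root` into
  -- an actual root.
  depressed-root : ∃[ y ] P ∣ depressed q r σ y
  depressed-root with Fin.any? (λ (i : Fin p) → P ∣? depressed q r σ (+ toℕ i))
  ... | yes (i , h) = + toℕ i , h
  ... | no none = ⊥-elim (¬¬root λ y h →
    none (residue y , depressed-cong y (+ toℕ (residue y)) (residue-∣ y) h))

  -- The roots of the resolvent are the squares of the sums of two roots of the quartic, so a double
  -- root y contributes (2y)². The identity writes g(4y²) as a combination of the quartic and its
  -- derivative at y.
  depressed-root-simple : ∀ y → P ∣ depressed q r σ y → ¬ P ∣ + 4 * (y * y * y) + + 2 * q * y + r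
  depressed-root-simple y hf hf′ = no-root (+ 4 * (y * y)) (∣-resp-≡
    (solve 4 (λ q r σ y →
        con (+ 4) :* (y :* y) :* (con (+ 4) :* (y :* y)) :* (con (+ 4) :* (y :* y))
        :+ con (+ 2) :* q :* (con (+ 4) :* (y :* y) :* (con (+ 4) :* (y :* y)))
        :+ (q :* q :- con (+ 4) :* σ) :* (con (+ 4) :* (y :* y)) :- r :* r
      := (:- (con (+ 16) :* (y :* y))) :* (y :* y :* y :* y :+ q :* (y :* y) :+ r :* y :+ σ)
         :+ (con (+ 20) :* (y :* y :* y) :+ con (+ 2) :* q :* y :- r) :* (con (+ 4) :* (y :* y :* y) :+ con (+ 2) :* q :* y :+ r)) q r σ y)
    (∣-lin₂ (- (+ 16 * (y * y))) (+ 20 * (y * y * y) + + 2 * q * y - r) hf hf′))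

-- Frobenius

-- The absorption identity for binomial coefficients, by induction through Pascal's rule.
[k+1]*[n+1]C[k+1]≡[n+1]*nCk : ∀ n k → suc k ℕ.* (suc n C suc k) ≡ suc n ℕ.* (n C k)
[k+1]*[n+1]C[k+1]≡[n+1]*nCk zero zero = refl
[k+1]*[n+1]C[k+1]≡[n+1]*nCk zero (suc k) = trans
  (cong (suc (suc k) ℕ.*_) (k>n⇒nCk≡0 {1} {suc (suc k)} (ℕ.s≤s (ℕ.s≤s ℕ.z≤n))))
  (trans (ℕ.*-zeroʳ (suc (suc k))) (sym (cong (1 ℕ.*_) (k>n⇒nCk≡0 {0} {suc k} (ℕ.s≤s ℕ.z≤n)))))
[k+1]*[n+1]C[k+1]≡[n+1]*nCk (suc n) zero =
  trans (ℕ.*-identityˡ (suc (suc n) C 1)) (trans (nC1≡n (suc (suc n))) (sym (ℕ.*-identityʳ (suc (suc n)))))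
[k+1]*[n+1]C[k+1]≡[n+1]*nCk (suc n) (suc k) = begin
  suc (suc k) ℕ.* (suc (suc n) C suc (suc k))
    ≡⟨ cong (suc (suc k) ℕ.*_) (nCk+nC[k+1]≡[n+1]C[k+1] (suc n) (suc k)) ⟨
  suc (suc k) ℕ.* (x ℕ.+ y)
    ≡⟨ ℕ.*-distribˡ-+ (suc (suc k)) x y ⟩
  x ℕ.+ suc k ℕ.* x ℕ.+ suc (suc k) ℕ.* y
    ≡⟨ cong₂ (λ u v → x ℕ.+ u ℕ.+ v) ([k+1]*[n+1]C[k+1]≡[n+1]*nCk n k) ([k+1]*[n+1]C[k+1]≡[n+1]*nCk n (suc k)) ⟩
  x ℕ.+ suc n ℕ.* (n C k) ℕ.+ suc n ℕ.* (n C suc k)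
    ≡⟨ ℕ.+-assoc x (suc n ℕ.* (n C k)) (suc n ℕ.* (n C suc k)) ⟩
  x ℕ.+ (suc n ℕ.* (n C k) ℕ.+ suc n ℕ.* (n C suc k))
    ≡⟨ cong (x ℕ.+_) (ℕ.*-distribˡ-+ (suc n) (n C k) (n C suc k)) ⟨
  x ℕ.+ suc n ℕ.* (n C k ℕ.+ n C suc k)
    ≡⟨ cong (λ z → x ℕ.+ suc n ℕ.* z) (nCk+nC[k+1]≡[n+1]C[k+1] n k) ⟩
  suc (suc n) ℕ.* x ∎
  where
  open ≡-Reasoning
  x = suc n C suc k
  y = suc n C suc (suc k)

-- By absorption p divides (k + 1) times the coefficient, and 0 < k + 1 < p.
prime∣pC[k+1] : ∀ {n k} → Prime (suc n) → k ℕ.< n → suc n ℕ.∣ (suc n C suc k)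
prime∣pC[k+1] {n} {k} p-prime k<n =
  [ (λ d → ⊥-elim (ℕ.>⇒∤ (ℕ.s≤s k<n) d)) , id ]′
    (euclidsLemma (suc k) (suc n C suc k) p-prime
      (ℕ.divides (n C k) (trans ([k+1]*[n+1]C[k+1]≡[n+1]*nCk n k) (ℕ.*-comm (suc n) (n C k)))))

module FreshmansDream {a ℓ} (S : CommutativeSemiring a ℓ) {n : ℕ} (p-prime : Prime (suc n)) where
  open CommutativeSemiring S renaming (Carrier to A; _+_ to _⊕_; _*_ to _⊗_; refl to ≈-refl; sym to ≈-sym; trans to ≈-trans; setoid to A-setoid)
  open Exp semiring renaming (_^_ to _↑_)
  open Mult semiring using (×-congʳ; ×-congˡ; ×-assocˡ) renaming (_×_ to _·_)
  open CommutativeMonoidMult +-commutativeMonoid using (×-distrib-+)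
  open Sum⁺ semiring using (sum; sum-init-last)
  open Binomial S using (theorem; binomialTerm; binomial)
  open import Relation.Binary.Reasoning.Setoid A-setoid as ≈-Reasoning

  sum-of-multiples : ∀ m k (f : Fin k → A) → (∀ i → ∃[ z ] f i ≈ m · z) → ∃[ z ] sum f ≈ m · z
  sum-of-multiples zero zero f h = 0# , ≈-refl
  sum-of-multiples (suc m) zero f h = 0# , ≈-sym (zeroes (suc m))
    where
    zeroes : ∀ m → m · 0# ≈ 0#
    zeroes zero = ≈-refl
    zeroes (suc m) = ≈-trans (+-identityˡ _) (zeroes m)
  sum-of-multiples m (suc k) f h =
    let z , hz = h Fin.zero
        w , hw = sum-of-multiples m k (f ∘ Fin.suc) (h ∘ Fin.suc)
    in z ⊕ w , ≈-trans (+-cong hz hw) (≈-sym (×-distrib-+ z w m))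

  abstract
    -- The error is an explicit multiple of p, so the result applies in ℤ[√D] without forming a
    -- quotient. The two outer binomial terms are the p-th powers; all inner coefficients are
    -- divisible by p.
    freshmansDream : ∀ x y → ∃[ z ] (x ⊕ y) ↑ suc n ≈ (x ↑ suc n ⊕ y ↑ suc n) ⊕ suc n · z
    freshmansDream x y = proj₁ inner , (begin
        (x ⊕ y) ↑ suc n                                       ≈⟨ theorem (suc n) x y ⟩
        t Fin.zero ⊕ sum (t ∘ Fin.suc)                        ≈⟨ +-congˡ (sum-init-last (t ∘ Fin.suc)) ⟩
        t Fin.zero ⊕ (sum middle ⊕ t (Fin.suc (fromℕ n)))     ≈⟨ +-cong first (+-cong (proj₂ inner) last′) ⟩
        y ↑ suc n ⊕ (suc n · z ⊕ x ↑ suc n)                   ≈⟨ +-congˡ (+-comm _ _) ⟩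
        y ↑ suc n ⊕ (x ↑ suc n ⊕ suc n · z)                   ≈⟨ +-assoc _ _ _ ⟨
        (y ↑ suc n ⊕ x ↑ suc n) ⊕ suc n · z                   ≈⟨ +-congʳ (+-comm _ _) ⟩
        (x ↑ suc n ⊕ y ↑ suc n) ⊕ suc n · z                   ∎)
      where
      t : Fin (suc (suc n)) → A
      t = binomialTerm x y (suc n)
      middle : Fin n → A
      middle i = t (Fin.suc (inject₁ i))
      coefficient : ∀ k → suc n ℕ.∣ k → ∀ b → ∃[ z ] k · b ≈ suc n · z
      coefficient _ (ℕ.divides c eq) b = c · b ,
        ≈-trans (×-congˡ (trans eq (ℕ.*-comm c (suc n)))) (≈-sym (×-assocˡ b (suc n) c))
      inner : ∃[ z ] sum middle ≈ suc n · z
      inner = sum-of-multiples (suc n) n middle (λ i → coefficient _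
        (prime∣pC[k+1] p-prime (subst (ℕ._< n) (sym (Fin.toℕ-inject₁ i)) (Fin.toℕ<n i))) (binomial x y (suc n) (Fin.suc (inject₁ i))))
      z : A
      z = proj₁ inner
      first : t Fin.zero ≈ y ↑ suc n
      first = ≈-trans (+-identityʳ _) (*-identityˡ _)
      last′ : t (Fin.suc (fromℕ n)) ≈ x ↑ suc n
      last′ = begin
        (suc n C suc (toℕ (fromℕ n))) · (x ↑ suc (toℕ (fromℕ n)) ⊗ y ↑ (n ℕ.∸ toℕ (fromℕ n)))
          ≡⟨ cong (λ k → (suc n C suc k) · (x ↑ suc k ⊗ y ↑ (n ℕ.∸ k))) (Fin.toℕ-fromℕ n) ⟩
        (suc n C suc n) · (x ↑ suc n ⊗ y ↑ (n ℕ.∸ n))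
          ≡⟨ cong₂ (λ c k → c · (x ↑ suc n ⊗ y ↑ k)) (nCn≡1 (suc n)) (ℕ.n∸n≡0 n) ⟩
        1 · (x ↑ suc n ⊗ 1#)   ≈⟨ +-identityʳ _ ⟩
        x ↑ suc n ⊗ 1#         ≈⟨ *-identityʳ _ ⟩
        x ↑ suc n              ∎

-- The ring ℤ[√D] and Lucas sequences

module QuadraticRing (D : ℤ) where

  open Biased (_≡_ {A = ℤ × ℤ}) using (isCommutativeSemiringˡ)

  infixl 6 _⊕_
  infixl 7 _⊗_

  -- The pair (a , b) stands for a + b√D, with √D a formal square root even when `D` is a square or
  -- 0.
  _⊕_ _⊗_ : ℤ × ℤ → ℤ × ℤ → ℤ × ℤ
  (a , b) ⊕ (c , d) = a + c , b + d
  (a , b) ⊗ (c , d) = a * c + D * (b * d) , a * d + b * c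

  commutativeSemiring : CommutativeSemiring 0ℓ 0ℓ
  commutativeSemiring = record
    { Carrier = ℤ × ℤ ; _≈_ = _≡_ ; _+_ = _⊕_ ; _*_ = _⊗_ ; 0# = 0ℤ , 0ℤ ; 1# = 1ℤ , 0ℤ
    ; isCommutativeSemiring = isCommutativeSemiringˡ record
      { +-isCommutativeMonoid = record
        { isMonoid = record
          { isSemigroup = record
            { isMagma = record { isEquivalence = isEquivalence ; ∙-cong = cong₂ _⊕_ }
            ; assoc = λ (a , b) (c , d) (e , f) → cong₂ _,_ (ℤ.+-assoc a c e) (ℤ.+-assoc b d f) }
          ; identity = (λ (a , b) → cong₂ _,_ (ℤ.+-identityˡ a) (ℤ.+-identityˡ b))
                     , (λ (a , b) → cong₂ _,_ (ℤ.+-identityʳ a) (ℤ.+-identityʳ b)) }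
        ; comm = λ (a , b) (c , d) → cong₂ _,_ (ℤ.+-comm a c) (ℤ.+-comm b d) }
      ; *-isCommutativeMonoid = record
        { isMonoid = record
          { isSemigroup = record
            { isMagma = record { isEquivalence = isEquivalence ; ∙-cong = cong₂ _⊗_ }
            ; assoc = λ (a , b) (c , d) (e , f) → cong₂ _,_
                (solve 7 (λ D a b c d e f → (a :* c :+ D :* (b :* d)) :* e :+ D :* ((a :* d :+ b :* c) :* f)
                   := a :* (c :* e :+ D :* (d :* f)) :+ D :* (b :* (c :* f :+ d :* e))) D a b c d e f)
                (solve 7 (λ D a b c d e f → (a :* c :+ D :* (b :* d)) :* f :+ (a :* d :+ b :* c) :* e
                   := a :* (c :* f :+ d :* e) :+ b :* (c :* e :+ D :* (d :* f))) D a b c d e f) }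
          ; identity =
              (λ (a , b) → cong₂ _,_
                (solve 3 (λ D a b → con 1ℤ :* a :+ D :* (con 0ℤ :* b) := a) D a b)
                (solve 2 (λ a b → con 1ℤ :* b :+ con 0ℤ :* a := b) a b))
            , (λ (a , b) → cong₂ _,_
                (solve 3 (λ D a b → a :* con 1ℤ :+ D :* (b :* con 0ℤ) := a) D a b)
                (solve 2 (λ a b → a :* con 0ℤ :+ b :* con 1ℤ := b) a b)) }
        ; comm = λ (a , b) (c , d) → cong₂ _,_
            (solve 5 (λ D a b c d → a :* c :+ D :* (b :* d) := c :* a :+ D :* (d :* b)) D a b c d)
            (solve 4 (λ a b c d → a :* d :+ b :* c := c :* b :+ d :* a) a b c d) }
      ; distribʳ = λ (a , b) (c , d) (e , f) → cong₂ _,_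
            (solve 7 (λ D a b c d e f → (c :+ e) :* a :+ D :* ((d :+ f) :* b)
               := c :* a :+ D :* (d :* b) :+ (e :* a :+ D :* (f :* b))) D a b c d e f)
            (solve 6 (λ a b c d e f → (c :+ e) :* b :+ (d :+ f) :* a
               := c :* b :+ d :* a :+ (e :* b :+ f :* a)) a b c d e f)
      ; zeroˡ = λ (a , b) → cong₂ _,_
            (solve 3 (λ D a b → con 0ℤ :* a :+ D :* (con 0ℤ :* b) := con 0ℤ) D a b)
            (solve 2 (λ a b → con 0ℤ :* b :+ con 0ℤ :* a := con 0ℤ) a b)
      }
    }

  open CommutativeSemiring commutativeSemiring using (semiring)
  open Exp semiring public using () renaming (_^_ to _↑_)
  open Mult semiring public using () renaming (_×_ to _·_)

  abstract
    ·-components : ∀ k (z : ℤ × ℤ) → k · z ≡ (+ k * proj₁ z , + k * proj₂ z)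
    ·-components zero (a , b) = refl
    ·-components (suc k) (a , b) = trans (cong ((a , b) ⊕_) (·-components k (a , b)))
      (cong₂ _,_ (step a) (step b))
      where
      step : ∀ a → a + + k * a ≡ + suc k * a
      step a = sym (ℤ.suc-* (+ k) a)

    ↑-rational : ∀ x k → (x , 0ℤ) ↑ k ≡ (x ^ k , 0ℤ)
    ↑-rational x zero = refl
    ↑-rational x (suc k) = trans (cong ((x , 0ℤ) ⊗_) (↑-rational x k)) (cong₂ _,_
      (solve 3 (λ D x y → x :* y :+ D :* (con 0ℤ :* con 0ℤ) := x :* y) D x (x ^ k))
      (solve 2 (λ x y → x :* con 0ℤ :+ con 0ℤ :* y := con 0ℤ) x (x ^ k)))

    ↑-√D : ∀ h → (0ℤ , 1ℤ) ↑ (h ℕ.+ h) ≡ (D ^ h , 0ℤ) × (0ℤ , 1ℤ) ↑ suc (h ℕ.+ h) ≡ (0ℤ , D ^ h)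
    ↑-√D h = even h , trans (cong ((0ℤ , 1ℤ) ⊗_) (even h)) (cong₂ _,_
        (solve 2 (λ D y → con 0ℤ :* y :+ D :* (con 1ℤ :* con 0ℤ) := con 0ℤ) D (D ^ h))
        (solve 1 (λ y → con 0ℤ :* con 0ℤ :+ con 1ℤ :* y := y) (D ^ h)))
      where
      even : ∀ h → (0ℤ , 1ℤ) ↑ (h ℕ.+ h) ≡ (D ^ h , 0ℤ)
      even zero = refl
      even (suc h) = trans (cong (λ k → (0ℤ , 1ℤ) ⊗ (0ℤ , 1ℤ) ↑ k) (ℕ.+-suc h h))
        (trans (cong (λ z → (0ℤ , 1ℤ) ⊗ ((0ℤ , 1ℤ) ⊗ z)) (even h)) (cong₂ _,_
          (solve 2 (λ D y → con 0ℤ :* (con 0ℤ :* y :+ D :* (con 1ℤ :* con 0ℤ))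
              :+ D :* (con 1ℤ :* (con 0ℤ :* con 0ℤ :+ con 1ℤ :* y)) := D :* y) D (D ^ h))
          (solve 2 (λ D y → con 0ℤ :* (con 0ℤ :* con 0ℤ :+ con 1ℤ :* y)
              :+ con 1ℤ :* (con 0ℤ :* y :+ D :* (con 1ℤ :* con 0ℤ)) := con 0ℤ) D (D ^ h))))

-- The power sums of the two roots of t² - βt + γ.
lucas : (β γ : ℤ) → ℕ → ℤ
lucas β γ 0 = + 2
lucas β γ 1 = β
lucas β γ (suc (suc n)) = β * lucas β γ (suc n) - γ * lucas β γ n

module LucasPowers (β γ : ℤ) where
  D : ℤ
  D = β * β - + 4 * γ
  open QuadraticRing D

  root : ℕ → ℤ × ℤ
  root k = (β , 1ℤ) ↑ k

  -- β + √D is twice a root of t² - βt + γ.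
  lucas-trace : ∀ k → (+ 2) ^ k * lucas β γ k ≡ + 2 * proj₁ (root k)
                    × (+ 2) ^ suc k * lucas β γ (suc k) ≡ + 2 * proj₁ (root (suc k))
  lucas-trace zero = refl , solve 2 (λ β γ → con (+ 2) :* con 1ℤ :* β
      := con (+ 2) :* (β :* con 1ℤ :+ (β :* β :- con (+ 4) :* γ) :* (con 1ℤ :* con 0ℤ))) β γ
  lucas-trace (suc k) =
    let ih₀ , ih₁ = lucas-trace k
    in ih₁ , step ((+ 2) ^ k) (lucas β γ k) (lucas β γ (suc k)) (proj₁ (root k)) (proj₂ (root k)) ih₀ ih₁
    where
    -- Here `t` is 2^k and A + B√D is (β + √D)^k; the trace of an element of ℤ[√D] is twice its
    -- rational part.
    step : ∀ t w₀ w₁ A B → t * w₀ ≡ + 2 * A → + 2 * t * w₁ ≡ + 2 * (β * A + D * (1ℤ * B)) →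
      + 2 * (+ 2 * t) * (β * w₁ - γ * w₀) ≡
      + 2 * (β * (β * A + D * (1ℤ * B)) + D * (1ℤ * (β * B + 1ℤ * A)))
    step t w₀ w₁ A B e₀ e₁ = trans
      (solve 5 (λ β γ t w₀ w₁ → con (+ 2) :* (con (+ 2) :* t) :* (β :* w₁ :- γ :* w₀)
        := con (+ 2) :* β :* (con (+ 2) :* t :* w₁) :- con (+ 4) :* γ :* (t :* w₀)) β γ t w₀ w₁)
      (trans (cong₂ (λ u v → + 2 * β * u - + 4 * γ * v) e₁ e₀)
      (solve 4 (λ β γ A B →
         let D = β :* β :- con (+ 4) :* γ in
         con (+ 2) :* β :* (con (+ 2) :* (β :* A :+ D :* (con 1ℤ :* B))) :- con (+ 4) :* γ :* (con (+ 2) :* A)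
         := con (+ 2) :* (β :* (β :* A :+ D :* (con 1ℤ :* B)) :+ D :* (con 1ℤ :* (β :* B :+ con 1ℤ :* A)))) β γ A B))

^-cong-mod : ∀ {m} x y k → m ∣ x - y → m ∣ x ^ k - y ^ k
^-cong-mod x y zero h = divides 0ℤ refl
^-cong-mod x y (suc k) h = ∣-resp-≡
  (solve 4 (λ x y u v → x :* u :- y :* v := u :* (x :- y) :+ y :* (u :- v)) x y (x ^ k) (y ^ k))
  (∣-lin₂ (x ^ k) y h (^-cong-mod x y k h))

^-distribʳ-* : ∀ x y k → (x * y) ^ k ≡ x ^ k * y ^ k
^-distribʳ-* x y zero = refl
^-distribʳ-* x y (suc k) = trans (cong (λ z → x * y * z) (^-distribʳ-* x y k))
  (solve 4 (λ x y u v → x :* y :* (u :* v) := x :* u :* (y :* v)) x y (x ^ k) (y ^ k))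

module Frobenius {n : ℕ} (p-prime : Prime (suc n)) where
  open PrimeModulus p-prime

  -- Taking D = 0 and rational elements of ℤ[√D] gives the integers.
  abstract
    ^p-additive : ∀ x y → P ∣ (x + y) ^ p - (x ^ p + y ^ p)
    ^p-additive x y =
      let open QuadraticRing 0ℤ
          open FreshmansDream commutativeSemiring p-prime
          z , eq = freshmansDream (x , 0ℤ) (y , 0ℤ)
      in divides (proj₁ z) (difference _ _ _ (trans (sym (cong proj₁ (↑-rational (x + y) p)))
           (trans (cong proj₁ eq) (cong₂ _+_
             (cong₂ _+_ (cong proj₁ (↑-rational x p)) (cong proj₁ (↑-rational y p)))
             (cong proj₁ (·-components p z))))))
      where
      difference : ∀ a b c → a ≡ b + P * c → a - b ≡ c * P
      difference a b c refl = solve 3 (λ b c m → b :+ m :* c :- b := c :* m) b c P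

    -- Induction on `k` with (k + 1)^p ≡ k^p + 1.
    fermat-ℕ : ∀ k → P ∣ (+ k) ^ p - + k
    fermat-ℕ zero = divides 0ℤ refl
    fermat-ℕ (suc k) = subst (λ z → P ∣ z ^ p - z) (ℤ.+-comm (+ k) 1ℤ)
      (∣-resp-≡ (solve 4 (λ x u v w → u :- (x :+ con 1ℤ) := con 1ℤ :* (u :- (v :+ w)) :+ con 1ℤ :* (v :- x) :+ con 1ℤ :* (w :- con 1ℤ))
          (+ k) ((+ k + 1ℤ) ^ p) ((+ k) ^ p) (1ℤ ^ p))
        (∣-lin₃ 1ℤ 1ℤ 1ℤ (^p-additive (+ k) 1ℤ) (fermat-ℕ k) (subst (λ z → P ∣ z - 1ℤ) (sym (ℤ.^-zeroˡ p)) (divides 0ℤ refl))))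

    fermat : ∀ x → P ∣ x ^ p - x
    fermat x = ∣-resp-≡
      (solve 4 (λ x y u v → u :- x := con 1ℤ :* (u :- v) :+ con 1ℤ :* (v :- y) :+ con -1ℤ :* (x :- y))
        x y (x ^ p) (y ^ p))
      (∣-lin₃ 1ℤ 1ℤ -1ℤ (^-cong-mod x y p (residue-∣ x)) (fermat-ℕ (toℕ (residue x))) (residue-∣ x))
      where
      y : ℤ
      y = + toℕ (residue x)

  module OddPrime (2<p : 2 ℕ.< suc n) where

    -- This is (p - 1)/2, so `D ^ h` is the quadratic character of `D` mod p.
    h : ℕ
    h = proj₁ (odd 2<p)

    p≡ : p ≡ suc (h ℕ.+ h)
    p≡ = proj₂ (odd 2<p)

    fermat-half : ∀ x → P ∣ x * (x ^ h * x ^ h) - x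
    fermat-half x = ∣-resp-≡ (cong (λ z → x * z - x) (sym (ℤ.^-distribˡ-+-* x h h)))
      (subst (λ k → P ∣ x ^ k - x) p≡ (fermat x))

    -- (β + √D)^p ≡ β + D^h √D and p ∣ 2^(p+1) - 4.
    lucas-mod : ∀ β γ → let D = β * β - + 4 * γ in
      P ∣ + 2 * lucas β γ (suc p) - (β * β + D * D ^ h)
    lucas-mod β γ = result
      where
      open LucasPowers β γ
      open QuadraticRing D
      open FreshmansDream commutativeSemiring p-prime
      z : ∃[ z ] (β + 0ℤ , 0ℤ + 1ℤ) ↑ p ≡ ((β , 0ℤ) ↑ p ⊕ (0ℤ , 1ℤ) ↑ p) ⊕ p · z
      z = freshmansDream (β , 0ℤ) (0ℤ , 1ℤ)
      a b : ℤ
      a = proj₁ (proj₁ z)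
      b = proj₂ (proj₁ z)
      root-p : root p ≡ (β ^ p + 0ℤ + P * a , 0ℤ + D ^ h + P * b)
      root-p = trans (cong (λ x → (x , 1ℤ) ↑ p) (sym (ℤ.+-identityʳ β)))
        (trans (proj₂ z) (cong₂ _⊕_ (cong₂ _⊕_ (↑-rational β p)
          (trans (cong ((0ℤ , 1ℤ) ↑_) p≡) (proj₂ (↑-√D h)))) (·-components p (proj₁ z))))
      trace : (+ 2) ^ suc p * lucas β γ (suc p) ≡
              + 2 * (β * (β ^ p + 0ℤ + P * a) + D * (1ℤ * (0ℤ + D ^ h + P * b)))
      trace = trans (proj₁ (lucas-trace (suc p)))
        (cong (λ z → + 2 * (β * proj₁ z + D * (1ℤ * proj₂ z))) root-p)
      -- `E`, `t` and `βp` stand for `D ^ h`, `2 ^ p` and `β ^ p`. Fermat reduces the last two to 2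
      -- and `β`, and the multiples of p drop out.
      combine-mod : ∀ D β m a b w E t βp → + 2 * t * w ≡ + 2 * (β * (βp + 0ℤ + m * a) + D * (1ℤ * (0ℤ + E + m * b))) →
        m ∣ t - + 2 → m ∣ βp - β → m ∣ + 2 * (+ 2 * w - (β * β + D * E))
      combine-mod D β m a b w E t βp eq ht hβ = ∣-resp-≡
        (trans (solve 5 (λ D β w E t → con (+ 2) :* (con (+ 2) :* w :- (β :* β :+ D :* E))
           := con (+ 2) :* t :* w :+ (:- (con (+ 2) :* w)) :* (t :- con (+ 2)) :- con (+ 2) :* (β :* β :+ D :* E)) D β w E t)
        (trans (cong (λ u → u + (- (+ 2 * w)) * (t - + 2) - + 2 * (β * β + D * E)) eq)
        (solve 9 (λ D β m a b w E t βp →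
            con (+ 2) :* (β :* (βp :+ con 0ℤ :+ m :* a) :+ D :* (con 1ℤ :* (con 0ℤ :+ E :+ m :* b)))
              :+ (:- (con (+ 2) :* w)) :* (t :- con (+ 2)) :- con (+ 2) :* (β :* β :+ D :* E)
            := (:- (con (+ 2) :* w)) :* (t :- con (+ 2)) :+ (con (+ 2) :* β) :* (βp :- β) :+ (con (+ 2) :* (β :* a :+ D :* b)) :* m)
            D β m a b w E t βp)))
        (∣-lin₃ (- (+ 2 * w)) (+ 2 * β) (+ 2 * (β * a + D * b)) ht hβ ∣-refl)
      result : P ∣ + 2 * lucas β γ (suc p) - (β * β + D * D ^ h)
      result = ∤-cancelˡ (2∤ 2<p) (combine-mod D β P a b (lucas β γ (suc p)) (D ^ h) ((+ 2) ^ p) (β ^ p) trace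
        (fermat (+ 2)) (fermat β))

-- Roots of the resolvent cubic

-- In terms of q, r and σ, the characteristic polynomial of the recurrence is visibly the resolvent
-- cubic.
s-recurrence : ∀ a c d e n → let q = a * c ; r = a * a * d ; σ = a * a * a * e in
  s a c d e (suc (suc (suc n))) ≡
    - (+ 2 * q) * s a c d e (suc (suc n)) + (+ 4 * σ - q * q) * s a c d e (suc n) + r * r * s a c d e n
s-recurrence a c d e n = cong₂ _+_ (cong₂ _+_
    (cong (_* s a c d e (suc (suc n))) (solve 2 (λ a c → :- con (+ 2) :* a :* c := :- (con (+ 2) :* (a :* c))) a c))
    (cong (_* s a c d e (suc n)) (solve 3 (λ a c e → con (+ 4) :* a :^ 3 :* e :- a :^ 2 :* c :^ 2
       := con (+ 4) :* (a :* a :* a :* e) :- a :* c :* (a :* c)) a c e)))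
  (cong (_* s a c d e n) (solve 2 (λ a d → a :^ 4 :* d :^ 2 := a :* a :* d :* (a :* a :* d)) a d))

module _ (m a c d e α : ℤ) where
  private
    q r σ β γ : ℤ
    q = a * c
    r = a * a * d
    σ = a * a * a * e
    β = - (+ 2 * q) - α
    γ = q * q - + 4 * σ - α * β

  -- For a root α of the resolvent, t² - βt + γ is the cofactor of t - α.
  s-power-sum : m ∣ resolvent q r σ α → ∀ n → m ∣ s a c d e n - (α ^ n + lucas β γ n)
  s-power-sum hα n = proj₁ (go n)
    where
    Claim : ℕ → Set
    Claim n = m ∣ s a c d e n - (α ^ n + lucas β γ n)
    -- Since g(t) = (t - α)(t² - βt + γ) + g(α), the powers of `α` and the Lucas sequence both
    -- satisfy the recurrence of `s` up to multiples of g(α).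
    step : ∀ q r σ α s₀ s₁ s₂ A w₀ w₁ → let β = - (+ 2 * q) - α ; γ = q * q - + 4 * σ - α * β in
      m ∣ resolvent q r σ α → m ∣ s₀ - (A + w₀) → m ∣ s₁ - (α * A + w₁) →
      m ∣ s₂ - (α * (α * A) + (β * w₁ - γ * w₀)) →
      m ∣ - (+ 2 * q) * s₂ + (+ 4 * σ - q * q) * s₁ + r * r * s₀
            - (α * (α * (α * A)) + (β * (β * w₁ - γ * w₀) - γ * w₁))
    step q r σ α s₀ s₁ s₂ A w₀ w₁ hα h₀ h₁ h₂ = ∣-resp-≡
      (solve 10 (λ q r σ α s₀ s₁ s₂ A w₀ w₁ →
         let β = :- (con (+ 2) :* q) :- α ; γ = q :* q :- con (+ 4) :* σ :- α :* β in
         :- (con (+ 2) :* q) :* s₂ :+ (con (+ 4) :* σ :- q :* q) :* s₁ :+ r :* r :* s₀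
            :- (α :* (α :* (α :* A)) :+ (β :* (β :* w₁ :- γ :* w₀) :- γ :* w₁))
         := (con 1ℤ :* (:- (con (+ 2) :* q) :* (s₂ :- (α :* (α :* A) :+ (β :* w₁ :- γ :* w₀)))
              :+ (con (+ 4) :* σ :- q :* q) :* (s₁ :- (α :* A :+ w₁))
              :+ r :* r :* (s₀ :- (A :+ w₀)))
            :+ (:- (A :+ w₀)) :* (α :* α :* α :+ con (+ 2) :* q :* (α :* α) :+ (q :* q :- con (+ 4) :* σ) :* α :- r :* r)))
         q r σ α s₀ s₁ s₂ A w₀ w₁)
      (∣-lin₂ 1ℤ (- (A + w₀)) (∣-lin₃ (- (+ 2 * q)) (+ 4 * σ - q * q) (r * r) h₂ h₁ h₀) hα)
    zero∣ : ∀ {x y} → x ≡ y → m ∣ x - y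
    zero∣ {x} refl = divides 0ℤ (ℤ.+-inverseʳ x)
    go : ∀ n → Claim n × Claim (suc n) × Claim (suc (suc n))
    go zero = zero∣ {+ 3} refl
      , zero∣ (solve 3 (λ a c α → :- con (+ 2) :* a :* c := α :* con 1ℤ :+ (:- (con (+ 2) :* (a :* c)) :- α)) a c α)
      , zero∣ (solve 4 (λ a c e α →
           let β = :- (con (+ 2) :* (a :* c)) :- α
               γ = a :* c :* (a :* c) :- con (+ 4) :* (a :* a :* a :* e) :- α :* β in
           con (+ 2) :* a :^ 2 :* c :^ 2 :+ con (+ 8) :* a :^ 3 :* e
           := α :* (α :* con 1ℤ) :+ (β :* β :- γ :* con (+ 2))) a c e α)
    go (suc n) =
      let h₀ , h₁ , h₂ = go n
      in h₁ , h₂ , ∣-resp-≡ (cong (_- (α ^ suc (suc (suc n)) + lucas β γ (suc (suc (suc n))))) (s-recurrence a c d e n))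
           (step q r σ α (s a c d e n) (s a c d e (suc n)) (s a c d e (suc (suc n)))
             (α ^ n) (lucas β γ n) (lucas β γ (suc n)) hα h₀ h₁ h₂)

module Resolvent {n : ℕ} (p-prime : Prime (suc n)) (2<p : 2 ℕ.< suc n) where
  open PrimeModulus p-prime
  open Frobenius p-prime
  open OddPrime 2<p

  module _ (q σ α : ℤ) where
    private
      -- `D` is the discriminant of the cofactor t² - βt + γ, and δ² - D is four times the value of
      -- the cofactor at `α`.
      β γ D δ : ℤ
      β = - (+ 2 * q) - α
      γ = q * q - + 4 * σ - α * β
      D = β * β - + 4 * γ
      δ = + 2 * α - β

    -- If DE ≡ D, then w ≡ β² - 2γ, so S ≡ α² + β² - 2γ = 2q² + 8σ. Comparison with q² - 4σ leaves
    -- q² + 12σ ≡ 0.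
    split-discriminant : ∀ S w E → P ∣ S - (α * α + w) → P ∣ + 2 * w - (β * β + D * E) →
      P ∣ S - (q * q - + 4 * σ) → P ∣ D * E - D → P ∣ q * q + + 12 * σ
    split-discriminant S w E hS hw hs hE = ∤-cancelˡ (2∤ 2<p) (∣-resp-≡
      (solve 6 (λ q σ α S w E →
         let β = :- (con (+ 2) :* q) :- α ; γ = q :* q :- con (+ 4) :* σ :- α :* β
             D = β :* β :- con (+ 4) :* γ in
         con (+ 2) :* (q :* q :+ con (+ 12) :* σ)
         := con 1ℤ :* (con (- + 2) :* (S :- (α :* α :+ w)) :+ con -1ℤ :* (con (+ 2) :* w :- (β :* β :+ D :* E)))
            :+ con 1ℤ :* (con (+ 2) :* (S :- (q :* q :- con (+ 4) :* σ)) :+ con -1ℤ :* (D :* E :- D))) q σ α S w E)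
      (∣-lin₂ 1ℤ 1ℤ (∣-lin₂ (- + 2) -1ℤ hS hw) (∣-lin₂ (+ 2) -1ℤ hs hE)))

    -- If DE ≡ -D, then w ≡ 2γ and S ≡ α² + 2γ. Comparison with q² - 4σ = αβ + γ gives α² - αβ + γ ≡
    -- 0.
    inert-discriminant : ∀ S w E → P ∣ S - (α * α + w) → P ∣ + 2 * w - (β * β + D * E) →
      P ∣ S - (q * q - + 4 * σ) → P ∣ D * E + D → P ∣ δ * δ - D
    inert-discriminant S w E hS hw hs hE = ∣-resp-≡
      (solve 6 (λ q σ α S w E →
         let β = :- (con (+ 2) :* q) :- α ; γ = q :* q :- con (+ 4) :* σ :- α :* β
             D = β :* β :- con (+ 4) :* γ ; δ = con (+ 2) :* α :- β in
         δ :* δ :- D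
         := con 1ℤ :* (con (- + 4) :* (S :- (α :* α :+ w)) :+ con (- + 2) :* (con (+ 2) :* w :- (β :* β :+ D :* E)))
            :+ con 1ℤ :* (con (+ 4) :* (S :- (q :* q :- con (+ 4) :* σ)) :+ con (- + 2) :* (D :* E :+ D))) q σ α S w E)
      (∣-lin₂ 1ℤ 1ℤ (∣-lin₂ (- + 4) (- + 2) hS hw) (∣-lin₂ (+ 4) (- + 2) hs hE))

    -- `F` is δ^(p - 1). If D ≡ δ², then E ≡ F, and Fermat for δ yields DE ≡ D.
    square-discriminant : ∀ E F → P ∣ δ * δ - D → P ∣ F - E → P ∣ δ * F - δ → P ∣ D * E - D
    square-discriminant E F = lemma D δ
      where
      lemma : ∀ D δ → P ∣ δ * δ - D → P ∣ F - E → P ∣ δ * F - δ → P ∣ D * E - D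
      lemma D δ hδ hF hδF = ∣-resp-≡
        (solve 4 (λ D δ E F → D :* E :- D := (con 1ℤ :- F) :* (δ :* δ :- D) :+ (:- D) :* (F :- E) :+ δ :* (δ :* F :- δ)) D δ E F)
        (∣-lin₃ (1ℤ - F) (- D) δ hδ hF hδF)

  -- Fermat for `D` gives D(E - 1)(E + 1) ≡ 0. If D ≡ 0 or E ≡ 1, then DE ≡ D, which the hypothesis
  -- on q² + 12σ excludes. If E ≡ -1, then D is the square δ², which again gives DE ≡ D.
  no-root-if-power-sum : ∀ a c d e → let q = a * c ; r = a * a * d ; σ = a * a * a * e in
    ¬ P ∣ q * q + + 12 * σ → P ∣ s a c d e (suc p) - (q * q - + 4 * σ) → ∀ α → ¬ P ∣ resolvent q r σ α
  no-root-if-power-sum a c d e q²+12σ∤ hs α hα =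
    [ split ∘ (λ hD → ∣-resp-≡ (factor D E) (∣m⇒∣m*n (E - 1ℤ) hD))
    , [ split ∘ (λ hE → ∣-resp-≡ (factor D E) (∣n⇒∣m*n D hE)) , inert ]′ ∘ euclid (E - 1ℤ) (E + 1ℤ)
    ]′ (euclid D ((E - 1ℤ) * (E + 1ℤ)) (∣-resp-≡
          (solve 2 (λ D E → D :* ((E :- con 1ℤ) :* (E :+ con 1ℤ)) := D :* (E :* E) :- D) D E) (fermat-half D)))
    where
    q σ β γ D E δ w S : ℤ
    q = a * c
    σ = a * a * a * e
    β = - (+ 2 * q) - α
    γ = q * q - + 4 * σ - α * β
    D = β * β - + 4 * γ
    E = D ^ h
    δ = + 2 * α - β
    w = lucas β γ (suc p)
    S = s a c d e (suc p)
    factor : ∀ D E → D * E - D ≡ D * (E - 1ℤ)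
    factor = solve 2 (λ D E → D :* E :- D := D :* (E :- con 1ℤ))
    hS : P ∣ S - (α * α + w)
    hS = ∣-resp-≡
      (solve 4 (λ S α w A → S :- (α :* α :+ w) := con 1ℤ :* (S :- (α :* A :+ w)) :+ α :* (A :- α)) S α w (α ^ p))
      (∣-lin₂ 1ℤ α (s-power-sum P a c d e α hα (suc p)) (fermat α))
    split : ¬ P ∣ D * E - D
    split hE = q²+12σ∤ (split-discriminant q σ α S w E hS (lucas-mod β γ) hs hE)
    inert : ¬ P ∣ E + 1ℤ
    inert hE = split (square-discriminant q σ α E (δ ^ h * δ ^ h) δ²≋D
        (subst (λ F → P ∣ F - E) (^-distribʳ-* δ δ h) (^-cong-mod (δ * δ) D h δ²≋D)) (fermat-half δ))
      where
      δ²≋D : P ∣ δ * δ - D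
      δ²≋D = inert-discriminant q σ α S w E hS (lucas-mod β γ) hs
        (∣-resp-≡ (solve 2 (λ D E → D :* E :+ D := D :* (E :+ con 1ℤ)) D E) (∣n⇒∣m*n D hE))

  no-root-if-noncube : ∀ q r σ → P ∣ q * q + + 12 * σ →
    (∀ t → ¬ P ∣ t * t * t - (+ 8 * (q * q * q) + + 27 * (r * r))) → ∀ α → ¬ P ∣ resolvent q r σ α
  no-root-if-noncube q r σ h₁ noncube α hα = noncube (+ 3 * α + + 2 * q) (∣-resp-≡
    (solve 4 (λ q r σ α → let t = con (+ 3) :* α :+ con (+ 2) :* q in
        t :* t :* t :- (con (+ 8) :* (q :* q :* q) :+ con (+ 27) :* (r :* r))
        := con (+ 27) :* (α :* α :* α :+ con (+ 2) :* q :* (α :* α) :+ (q :* q :- con (+ 4) :* σ) :* α :- r :* r)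
           :+ (con (+ 9) :* α) :* (q :* q :+ con (+ 12) :* σ)) q r σ α)
    (∣-lin₂ (+ 27) (+ 9 * α) hα h₁))

-- Density

module Hensel {n : ℕ} (p-prime : Prime (suc n)) (a b c d e : ℤ) where
  open PrimeModulus p-prime

  f f′ : ℤ → ℤ
  f x = quartic a b c d e x 1ℤ
  f′ x = + 4 * a * (x * x * x) + + 3 * b * (x * x) + + 2 * c * x + d

  taylor : ∀ x z → f (x + z) ≡ f x + f′ x * z +
    z * z * (a * (+ 6 * (x * x) + + 4 * (x * z) + z * z) + b * (+ 3 * x + z) + c)
  taylor x z = solve 7 (λ a b c d e x z →
      let F = λ x → a :* x :^ 4 :+ b :* x :^ 3 :* con 1ℤ :+ c :* x :^ 2 :* con 1ℤ :^ 2 :+ d :* x :* con 1ℤ :^ 3 :+ e :* con 1ℤ :^ 4 in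
      F (x :+ z) := F x
        :+ (con (+ 4) :* a :* (x :* x :* x) :+ con (+ 3) :* b :* (x :* x) :+ con (+ 2) :* c :* x :+ d) :* z
        :+ z :* z :* (a :* (con (+ 6) :* (x :* x) :+ con (+ 4) :* (x :* z) :+ z :* z) :+ b :* (con (+ 3) :* x :+ z) :+ c))
    a b c d e x z

  f′-cong : ∀ x z → P ∣ z → P ∣ f′ (x + z) → P ∣ f′ x
  f′-cong x z hz h = ∣-resp-≡
    (solve 6 (λ a b c d x z →
      let F = λ x → con (+ 4) :* a :* (x :* x :* x) :+ con (+ 3) :* b :* (x :* x) :+ con (+ 2) :* c :* x :+ d in
      F x := con 1ℤ :* F (x :+ z) :+ (:- (con (+ 4) :* a :* (con (+ 3) :* (x :* x) :+ con (+ 3) :* (x :* z) :+ z :* z)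
             :+ con (+ 3) :* b :* (con (+ 2) :* x :+ z) :+ con (+ 2) :* c)) :* z) a b c d x z)
    (∣-lin₂ 1ℤ (- (+ 4 * a * (+ 3 * (x * x) + + 3 * (x * z) + z * z) + + 3 * b * (+ 2 * x + z) + + 2 * c)) h hz)

  abstract
    -- Newton iteration for f(x) = t: as p divides `t`, the root x₀ is already a solution mod p. The
    -- unit derivative is carried along so that each step can divide by it.
    hensel : ∀ x₀ → P ∣ f x₀ → ¬ P ∣ f′ x₀ → ∀ t → P ∣ t → ∀ k →
      ∃[ x ] (P ^ suc k ∣ f x - t) × ¬ P ∣ f′ x
    hensel x₀ h₀ h′ t ht zero = x₀ ,
      subst (_∣ f x₀ - t) (sym (ℤ.^-identityʳ P)) (∣m∣n⇒∣m-n h₀ ht) , h′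
    hensel x₀ h₀ h′ t ht (suc k) =
      let x , hx , hx′ = hensel x₀ h₀ h′ t ht k
          y , hy = inverse (f′ x) hx′
      in refine x (P ^ suc k) hx hx′ (∣m⇒∣m*n (P ^ k) ∣-refl) y hy
      where
      refine : ∀ x m → m ∣ f x - t → ¬ P ∣ f′ x → P ∣ m → ∀ y → P ∣ f′ x * y - 1ℤ →
        ∃[ x ] (P * m ∣ f x - t) × ¬ P ∣ f′ x
      refine x m (divides w eq) hx′ hm y hy = x + z ,
        ∣-resp-≡ (trans (cong (_- t) (taylor x z)) (expand (f x) t (f′ x) m w y K eq))
          (∣-lin₂ (- w) (w * y * (w * y) * K) (lift-∣ m hy) (lift-∣ m hm)) ,
        (λ h → hx′ (f′-cong x z (∣n⇒∣m*n (- (w * y)) hm) h))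
        where
        z K : ℤ
        -- The Newton correction -(f(x) - t)/f′(x). An inverse of f′(x) mod p suffices to gain one
        -- factor p, and the quadratic Taylor term is divisible by m², hence by pm.
        z = - (w * y) * m
        K = a * (+ 6 * (x * x) + + 4 * (x * z) + z * z) + b * (+ 3 * x + z) + c
        expand : ∀ fx t f′x m w y K → fx - t ≡ w * m →
          fx + f′x * (- (w * y) * m) + (- (w * y) * m) * (- (w * y) * m) * K - t ≡
          - w * (m * (f′x * y - 1ℤ)) + w * y * (w * y) * K * (m * m)
        expand fx t f′x m w y K eq = trans
          (solve 7 (λ fx t f′x m w y K → fx :+ f′x :* (:- (w :* y) :* m) :+ (:- (w :* y) :* m) :* (:- (w :* y) :* m) :* K :- t
            := (fx :- t) :+ f′x :* (:- (w :* y) :* m) :+ (:- (w :* y) :* m) :* (:- (w :* y) :* m) :* K) fx t f′x m w y K)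
          (trans (cong (λ u → u + f′x * (- (w * y) * m) + (- (w * y) * m) * (- (w * y) * m) * K) eq)
          (solve 5 (λ f′x m w y K → w :* m :+ f′x :* (:- (w :* y) :* m) :+ (:- (w :* y) :* m) :* (:- (w :* y) :* m) :* K
            := :- w :* (m :* (f′x :* y :- con 1ℤ)) :+ w :* y :* (w :* y) :* K :* (m :* m)) f′x m w y K))

-- The p-adic valuation on ℚ

cross-multiply : ∀ z u v → z ℚ.* fromℤ v ≡ fromℤ u → ↥ z * v ≡ u * ↧ z
cross-multiply z@(mkℚ _ _ _) u v eq
  with *≡* h ← ℚᵘ.≃-trans (ℚᵘ.≃-sym (ℚ.toℚᵘ-homo-* z (fromℤ v))) (ℚ.toℚᵘ-cong eq)
  = trans (sym (ℤ.*-identityʳ (↥ z * v))) (trans h (cong (u *_) (ℤ.*-identityʳ (↧ z))))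

uncross-multiply : ∀ z u v → ↥ z * v ≡ u * ↧ z → z ℚ.* fromℤ v ≡ fromℤ u
uncross-multiply z@(mkℚ _ _ _) u v eq = ℚ.toℚᵘ-injective (ℚᵘ.≃-trans (ℚ.toℚᵘ-homo-* z (fromℤ v))
  (*≡* (trans (ℤ.*-identityʳ (↥ z * v)) (trans eq (cong (u *_) (sym (ℤ.*-identityʳ (↧ z))))))))

fromℤ-* : ∀ x y → fromℤ x ℚ.* fromℤ y ≡ fromℤ (x * y)
fromℤ-* x y = uncross-multiply (fromℤ x) (x * y) y (sym (ℤ.*-identityʳ (x * y)))

fromℤ-+ : ∀ x y → fromℤ x ℚ.+ fromℤ y ≡ fromℤ (x + y)
fromℤ-+ x y = ℚ.toℚᵘ-injective (ℚᵘ.≃-trans (ℚ.toℚᵘ-homo-+ (fromℤ x) (fromℤ y))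
  (*≡* (cong (_* 1ℤ) (cong₂ _+_ (ℤ.*-identityʳ x) (ℤ.*-identityʳ y)))))

maxExponent-∣ : ∀ p n b → p ℕ.^ maxExponent p n b ℕ.∣ n
maxExponent-∣ p n zero = ℕ.1∣ n
maxExponent-∣ p n (suc b) with (p ℕ.^ suc b) ℕ.∣? n
... | yes d = d
... | no  _ = maxExponent-∣ p n b

maxExponent-maximal : ∀ p n b {j} → p ℕ.^ j ℕ.∣ n → j ℕ.≤ b → j ℕ.≤ maxExponent p n b
maxExponent-maximal p n zero d j≤b = j≤b
maxExponent-maximal p n (suc b) {j} d j≤b with (p ℕ.^ suc b) ℕ.∣? n
... | yes _ = j≤b
... | no ∤ = maxExponent-maximal p n b d (ℕ.≤-pred (ℕ.≤∧≢⇒< j≤b (λ { refl → ∤ d })))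

^-∣-^ : ∀ p {j k} → j ℕ.≤ k → p ℕ.^ j ℕ.∣ p ℕ.^ k
^-∣-^ p {j} {k} j≤k = subst (λ l → p ℕ.^ j ℕ.∣ p ℕ.^ l) (ℕ.m+[n∸m]≡n j≤k)
  (subst (p ℕ.^ j ℕ.∣_) (sym (ℕ.^-distribˡ-+-* p j (k ℕ.∸ j))) (ℕ.m∣m*n (p ℕ.^ (k ℕ.∸ j))))

k<m^k : ∀ {m} → 1 ℕ.< m → ∀ k → k ℕ.< m ℕ.^ k
k<m^k 1<m zero = ℕ.s≤s ℕ.z≤n
k<m^k {m} 1<m (suc k) = ℕ.≤-<-trans (k<m^k 1<m k) (ℕ.^-monoʳ-< m 1<m (ℕ.n<1+n k))

module Valuation {n : ℕ} (p-prime : Prime (suc n)) where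
  open PrimeModulus p-prime

  pos-^ : ∀ k → + (p ℕ.^ k) ≡ P ^ k
  pos-^ zero = refl
  pos-^ (suc k) = trans (ℤ.pos-* p (p ℕ.^ k)) (cong (P *_) (pos-^ k))

  P^∣⇒ : ∀ k {x} → P ^ k ∣ x → p ℕ.^ k ℕ.∣ ∣ x ∣
  P^∣⇒ k {x} h = ∣⇒∣ᵤ (subst (_∣ x) (sym (pos-^ k)) h)

  P^∣⇐ : ∀ k {x} → p ℕ.^ k ℕ.∣ ∣ x ∣ → P ^ k ∣ x
  P^∣⇐ k {x} h = subst (_∣ x) (pos-^ k) (∣ᵤ⇒∣ h)

  P^∣-cancelʳ : ∀ k x v → ¬ P ∣ v → P ^ k ∣ x * v → P ^ k ∣ x
  P^∣-cancelʳ zero x v _ _ = divides x (sym (ℤ.*-identityʳ x))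
  P^∣-cancelʳ (suc k) x v v∤ h
    with euclid x v (∣-trans (∣m⇒∣m*n (P ^ k) ∣-refl) h)
  ... | inj₂ d = ⊥-elim (v∤ d)
  ... | inj₁ (divides y refl) = subst (P ^ suc k ∣_) (ℤ.*-comm P y)
    (*-monoʳ-∣ P (P^∣-cancelʳ k y v v∤ (*-cancelˡ-∣ P (∣-resp-≡ (solve 3 (λ m y v → m :* (y :* v) := y :* m :* v) P y v) h))))

  exponent≥1⇒∣ : ∀ m → 1 ℕ.≤ exponent p m → p ℕ.∣ m
  exponent≥1⇒∣ m 1≤e = ℕ.∣-trans (divides-power (exponent p m) 1≤e) (maxExponent-∣ p m m)
    where
    divides-power : ∀ e → 1 ℕ.≤ e → p ℕ.∣ p ℕ.^ e
    divides-power (suc e) _ = ℕ.m∣m*n (p ℕ.^ e)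

  -- Membership in p^k ℤ_(p). The fraction need not be reduced, which makes sums easy to handle,
  -- whereas `ν` reads the reduced form.
  Small : ℕ → ℚ → Set
  Small k z = ∃[ u ] ∃[ v ] (¬ P ∣ v) × z ℚ.* fromℤ v ≡ fromℤ (P ^ k * u)

  private
    p∣num∧den⇒⊥ : ∀ {a b} → Coprime a b → p ℕ.∣ a → p ℕ.∣ b → ⊥
    p∣num∧den⇒⊥ c h₁ h₂ = ℕ.<⇒≢ 1<p (sym (c (h₁ , h₂)))

    Bound : ℕ → ℤ → ℕ → Set
    Bound k num d = + k ℤ.≤ + exponent p ∣ num ∣ - + exponent p (suc d)

    -- If p divided the denominator, the bound would make it divide the numerator too, against
    -- coprimality.
    bound⇒small : ∀ k num d .(c : Coprime ∣ num ∣ (suc d)) → Bound k num d → Small k (mkℚ num d c)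
    bound⇒small k num d c h = proj₁ numerator , + suc d , d∤ ,
      uncross-multiply (mkℚ num d c) (P ^ k * proj₁ numerator) (+ suc d)
        (cong (_* + suc d) (proj₂ numerator))
      where
      e₁ e₂ : ℕ
      e₁ = exponent p ∣ num ∣
      e₂ = exponent p (suc d)
      k+e₂≤e₁ : k ℕ.+ e₂ ℕ.≤ e₁
      k+e₂≤e₁ = ℤ.drop‿+≤+ (subst (+ (k ℕ.+ e₂) ℤ.≤_)
        (solve 2 (λ x y → x :- y :+ y := x) (+ e₁) (+ e₂)) (ℤ.+-monoˡ-≤ (+ e₂) h))
      d∤ : ¬ P ∣ + suc d
      d∤ hd = p∣num∧den⇒⊥ (Coprimality.recompute c) (exponent≥1⇒∣ ∣ num ∣ (ℕ.≤-trans 1≤e₂ (ℕ.≤-trans (ℕ.m≤n+m e₂ k) k+e₂≤e₁))) (∣⇒∣ᵤ hd)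
        where
        1≤e₂ : 1 ℕ.≤ e₂
        1≤e₂ = maxExponent-maximal p (suc d) (suc d) (subst (ℕ._∣ suc d) (sym (ℕ.*-identityʳ p)) (∣⇒∣ᵤ hd)) (ℕ.s≤s ℕ.z≤n)
      numerator : ∃[ u ] num ≡ P ^ k * u
      numerator with divides u eq ← P^∣⇐ k {num} (ℕ.∣-trans
          (^-∣-^ p (ℕ.≤-trans (ℕ.m≤m+n k e₂) k+e₂≤e₁)) (maxExponent-∣ p ∣ num ∣ ∣ num ∣))
        = u , trans eq (ℤ.*-comm u (P ^ k))

    small⇒bound : ∀ k num d .(c : Coprime ∣ num ∣ (suc d)) → .{{_ : ℕ.NonZero ∣ num ∣}} → Small k (mkℚ num d c) → Bound k num d
    small⇒bound k num d c (u , v , v∤ , eq) = subst (+ k ℤ.≤_) (sym e₁-e₂≡e₁) (+≤+ k≤e₁)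
      where
      cross : num * v ≡ P ^ k * u * + suc d
      cross = cross-multiply (mkℚ num d c) (P ^ k * u) v eq
      P^k∣num : P ^ k ∣ num
      P^k∣num = P^∣-cancelʳ k num v v∤ (subst (P ^ k ∣_) (sym cross) (∣m⇒∣m*n (+ suc d) (∣m⇒∣m*n u ∣-refl)))
      d∤ : ¬ p ℕ.∣ suc d
      d∤ hd = [ (λ hnum → p∣num∧den⇒⊥ (Coprimality.recompute c) (∣⇒∣ᵤ hnum) hd) , v∤ ]′
        (euclid num v (subst (P ∣_) (sym cross) (∣n⇒∣m*n (P ^ k * u) (∣ᵤ⇒∣ hd))))
      e₂≡0 : exponent p (suc d) ≡ 0
      e₂≡0 = ℕ.n<1⇒n≡0 (ℕ.≰⇒> (d∤ ∘ exponent≥1⇒∣ (suc d)))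
      e₁ : ℕ
      e₁ = exponent p ∣ num ∣
      e₁-e₂≡e₁ : + e₁ - + exponent p (suc d) ≡ + e₁
      e₁-e₂≡e₁ = trans (cong (λ e → + e₁ - + e) e₂≡0) (ℤ.+-identityʳ (+ e₁))
      k≤e₁ : k ℕ.≤ e₁
      k≤e₁ = maxExponent-maximal p ∣ num ∣ ∣ num ∣ (P^∣⇒ k P^k∣num)
        -- `exponent` only searches up to |num|, and k < p^k ≤ |num|.
        (ℕ.≤-trans (ℕ.<⇒≤ (k<m^k 1<p k)) (ℕ.∣⇒≤ (P^∣⇒ k P^k∣num)))

  ν≥⇒small : ∀ k z → [ + k ] ≤⁺ ν p z → Small k z
  ν≥⇒small k (mkℚ (+ zero) d c) _ = 0ℤ , 1ℤ , ∤-small 1<p ,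
    uncross-multiply (mkℚ (+ zero) d c) (P ^ k * 0ℤ) 1ℤ (sym (cong (_* + suc d) (ℤ.*-zeroʳ (P ^ k))))
  ν≥⇒small k (mkℚ (+ suc m) d c) [ h ] = bound⇒small k (+ suc m) d c h
  ν≥⇒small k (mkℚ -[1+ m ] d c) [ h ] = bound⇒small k -[1+ m ] d c h

  small⇒ν≥ : ∀ k z → Small k z → [ + k ] ≤⁺ ν p z
  small⇒ν≥ k (mkℚ (+ zero) d c) _ = [ + k ] ≤⊤⁺
  small⇒ν≥ k (mkℚ (+ suc m) d c) h = [ small⇒bound k (+ suc m) d c h ]
  small⇒ν≥ k (mkℚ -[1+ m ] d c) h = [ small⇒bound k -[1+ m ] d c h ]

  small-+ : ∀ k y z → Small k y → Small k z → Small k (y ℚ.+ z)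
  small-+ k y z (u₁ , v₁ , v₁∤ , eq₁) (u₂ , v₂ , v₂∤ , eq₂) =
    u₁ * v₂ + u₂ * v₁ , v₁ * v₂ , ∤-* v₁∤ v₂∤ , (begin
      (y ℚ.+ z) ℚ.* fromℤ (v₁ * v₂)
        ≡⟨ cong ((y ℚ.+ z) ℚ.*_) (sym (fromℤ-* v₁ v₂)) ⟩
      (y ℚ.+ z) ℚ.* (V₁ ℚ.* V₂)
        ≡⟨ ℚ.*-distribʳ-+ (V₁ ℚ.* V₂) y z ⟩
      y ℚ.* (V₁ ℚ.* V₂) ℚ.+ z ℚ.* (V₁ ℚ.* V₂)
        ≡⟨ cong₂ ℚ._+_ (sym (ℚ.*-assoc y V₁ V₂)) (trans (cong (z ℚ.*_) (ℚ.*-comm V₁ V₂)) (sym (ℚ.*-assoc z V₂ V₁))) ⟩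
      y ℚ.* V₁ ℚ.* V₂ ℚ.+ z ℚ.* V₂ ℚ.* V₁
        ≡⟨ cong₂ ℚ._+_ (cong (ℚ._* V₂) eq₁) (cong (ℚ._* V₁) eq₂) ⟩
      fromℤ (P ^ k * u₁) ℚ.* V₂ ℚ.+ fromℤ (P ^ k * u₂) ℚ.* V₁
        ≡⟨ cong₂ ℚ._+_ (fromℤ-* (P ^ k * u₁) v₂) (fromℤ-* (P ^ k * u₂) v₁) ⟩
      fromℤ (P ^ k * u₁ * v₂) ℚ.+ fromℤ (P ^ k * u₂ * v₁)
        ≡⟨ fromℤ-+ (P ^ k * u₁ * v₂) (P ^ k * u₂ * v₁) ⟩
      fromℤ (P ^ k * u₁ * v₂ + P ^ k * u₂ * v₁)
        ≡⟨ cong fromℤ (solve 5 (λ m u₁ v₁ u₂ v₂ → m :* u₁ :* v₂ :+ m :* u₂ :* v₁ := m :* (u₁ :* v₂ :+ u₂ :* v₁)) (P ^ k) u₁ v₁ u₂ v₂) ⟩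
      fromℤ (P ^ k * (u₁ * v₂ + u₂ * v₁)) ∎)
    where
    open ≡-Reasoning
    V₁ V₂ : ℚ
    V₁ = fromℤ v₁
    V₂ = fromℤ v₂

  -- The ultrametric inequality: differences in p^k ℤ_(p) add up inside it.
  close-trans : ∀ k x y z → Close p k x y → Close p k y z → Close p k x z
  close-trans k x y z h₁ h₂ = small⇒ν≥ k (x ℚ.- z) (subst (Small k) telescope
    (small-+ k (x ℚ.- y) (y ℚ.- z) (ν≥⇒small k (x ℚ.- y) h₁) (ν≥⇒small k (y ℚ.- z) h₂)))
    where
    telescope : (x ℚ.- y) ℚ.+ (y ℚ.- z) ≡ x ℚ.- z
    telescope = trans (ℚ.+-assoc x (ℚ.- y) (y ℚ.- z))
      (cong (x ℚ.+_) (trans (sym (ℚ.+-assoc (ℚ.- y) y (ℚ.- z)))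
        (trans (cong (ℚ._- z) (ℚ.+-inverseˡ y)) (ℚ.+-identityˡ (ℚ.- z)))))

  private
    positive-difference : ∀ e₁ e₂ → 0ℤ ℤ.< + e₁ - + e₂ → 1 ℕ.≤ e₁
    positive-difference (suc _) _ _ = ℕ.s≤s ℕ.z≤n
    positive-difference zero zero (+<+ ())

  positive⇒∣ : ∀ x → Positive (ν p (fromℤ x)) → P ∣ x
  positive⇒∣ (+ zero) _ = divides 0ℤ refl
  positive⇒∣ x@(+ suc _) [ h ] = ∣ᵤ⇒∣ (exponent≥1⇒∣ ∣ x ∣ (positive-difference (exponent p ∣ x ∣) (exponent p 1) h))
  positive⇒∣ x@(-[1+ _ ]) [ h ] = ∣ᵤ⇒∣ (exponent≥1⇒∣ ∣ x ∣ (positive-difference (exponent p ∣ x ∣) (exponent p 1) h))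

÷-cancel : ∀ x y .{{_ : ℚ.NonZero y}} → (x ℚ.÷ y) ℚ.* y ≡ x
÷-cancel x y = trans (ℚ.*-assoc x (ℚ.1/ y) y) (trans (cong (x ℚ.*_) (ℚ.*-inverseˡ y)) (ℚ.*-identityʳ x))

difference-of-fractions : ∀ y z u v u′ v′ → y ℚ.* fromℤ v ≡ fromℤ u → z ℚ.* fromℤ v′ ≡ fromℤ u′ →
  (y ℚ.- z) ℚ.* fromℤ (v * v′) ≡ fromℤ (u * v′ - u′ * v)
difference-of-fractions y z u v u′ v′ eq eq′ = begin
  (y ℚ.- z) ℚ.* fromℤ (v * v′)
    ≡⟨ cong ((y ℚ.- z) ℚ.*_) (fromℤ-* v v′) ⟨
  (y ℚ.- z) ℚ.* (V ℚ.* V′)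
    ≡⟨ ℚ.*-distribʳ-+ (V ℚ.* V′) y (ℚ.- z) ⟩
  y ℚ.* (V ℚ.* V′) ℚ.+ (ℚ.- z) ℚ.* (V ℚ.* V′)
    ≡⟨ cong (y ℚ.* (V ℚ.* V′) ℚ.+_) (sym (ℚ.neg-distribˡ-* z (V ℚ.* V′))) ⟩
  y ℚ.* (V ℚ.* V′) ℚ.- z ℚ.* (V ℚ.* V′)
    ≡⟨ cong₂ ℚ._-_ (sym (ℚ.*-assoc y V V′)) (trans (cong (z ℚ.*_) (ℚ.*-comm V V′)) (sym (ℚ.*-assoc z V′ V))) ⟩
  y ℚ.* V ℚ.* V′ ℚ.- z ℚ.* V′ ℚ.* V
    ≡⟨ cong₂ (λ s t → s ℚ.* V′ ℚ.- t ℚ.* V) eq eq′ ⟩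
  fromℤ u ℚ.* V′ ℚ.- fromℤ u′ ℚ.* V
    ≡⟨ cong₂ ℚ._-_ (fromℤ-* u v′) (fromℤ-* u′ v) ⟩
  fromℤ (u * v′) ℚ.- fromℤ (u′ * v)
    ≡⟨ cong (fromℤ (u * v′) ℚ.+_) (fromℤ-neg (u′ * v)) ⟩
  fromℤ (u * v′) ℚ.+ fromℤ (- (u′ * v))
    ≡⟨ fromℤ-+ (u * v′) (- (u′ * v)) ⟩
  fromℤ (u * v′ - u′ * v) ∎
  where
  open ≡-Reasoning
  V V′ : ℚ
  V = fromℤ v
  V′ = fromℤ v′
  fromℤ-neg : ∀ x → ℚ.- fromℤ x ≡ fromℤ (- x)
  fromℤ-neg (+ zero) = refl
  fromℤ-neg (+ suc _) = refl
  fromℤ-neg (ℤ.-[1+ _ ]) = refl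

-- Approximation of p-adic numbers by ratios of values

module Density {n : ℕ} (p-prime : Prime (suc n)) (a b c d e x₀ : ℤ) where
  open PrimeModulus p-prime
  open Valuation p-prime
  open Hensel p-prime a b c d e

  p-part : ∀ v → v ≢ 0ℤ → ∃[ j ] ∃[ v′ ] (v ≡ P ^ j * v′) × ¬ P ∣ v′
  p-part v v≢0 = j , quotient P^j∣v , v≡ , λ h → ℕ.1+n≰n (maxExponent-maximal p ∣ v ∣ ∣ v ∣ (too-big h)
      (ℕ.≤-trans (ℕ.<⇒≤ (k<m^k 1<p (suc j))) (ℕ.∣⇒≤ {{ℤ.≢-nonZero v≢0}} (too-big h))))
    where
    j : ℕ
    j = exponent p ∣ v ∣
    P^j∣v : P ^ j ∣ v
    P^j∣v = P^∣⇐ j (maxExponent-∣ p ∣ v ∣ ∣ v ∣)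
    v≡ : v ≡ P ^ j * quotient P^j∣v
    v≡ = trans (_∣_.equality P^j∣v) (ℤ.*-comm (quotient P^j∣v) (P ^ j))
    too-big : P ∣ quotient P^j∣v → p ℕ.^ suc j ℕ.∣ ∣ v ∣
    too-big h = P^∣⇒ (suc j) (subst (P ^ suc j ∣_) (sym v≡) (lift-∣ (P ^ j) h))

  module _ (root : P ∣ f x₀) (simple : ¬ P ∣ f′ x₀) where

    -- For y = u/v, Hensel's lemma brings F(x₁, 1) close to pu and F(x₂, 1) close to pv; the factor
    -- p makes both targets admissible.
    approximate : ∀ k y → ∃[ r ] Σ[ _ ∈ R (quartic a b c d e) r ] Close p k y r
    approximate k y = assemble (p-part v (λ ()))
      where
      u v : ℤ
      u = ↥ y
      v = ↧ y
      y*v : y ℚ.* fromℤ v ≡ fromℤ u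
      y*v = uncross-multiply y u v refl
      assemble : ∃[ j ] ∃[ v′ ] (v ≡ P ^ j * v′) × ¬ P ∣ v′ → ∃[ r ] Σ[ _ ∈ R (quartic a b c d e) r ] Close p k y r
      assemble (j , v′ , v≡ , v′∤) =
        let x₁ , h₁ , _ = hensel x₀ root simple (P * u) (∣m⇒∣m*n u ∣-refl) K
            x₂ , h₂ , _ = hensel x₀ root simple (P * v) (∣m⇒∣m*n v ∣-refl) K
        in fraction x₁ x₂ h₁ h₂
        where
        K : ℕ
        K = j ℕ.+ (suc j ℕ.+ k)
        g m : ℤ
        g = P ^ j
        m = P ^ suc K
        m≡ : m ≡ P * (g * (P * g * P ^ k))
        m≡ = cong (P *_) (trans (ℤ.^-distribˡ-+-* P j (suc j ℕ.+ k)) (cong (g *_) (ℤ.^-distribˡ-+-* P (suc j) k)))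
        fraction : ∀ x₁ x₂ → m ∣ f x₁ - P * u → m ∣ f x₂ - P * v → ∃[ r ] Σ[ _ ∈ R (quartic a b c d e) r ] Close p k y r
        fraction x₁ x₂ (divides A eq₁) (divides B eq₂) =
          r , (x₁ , 1ℤ , x₂ , 1ℤ , F₂≢0 , refl) ,
          small⇒ν≥ k (y ℚ.- r) (P * (u * B - A * v) , v′ * v″ , ∤-* v′∤ v″∤ ,
            uncross-multiply (y ℚ.- r) (P ^ k * (P * (u * B - A * v))) (v′ * v″) cancelled)
          where
          F₁ F₂ v″ : ℤ
          F₁ = f x₁
          F₂ = f x₂
          -- The prime-to-p part of F₂, congruent to the unit `v′` mod p.
          v″ = v′ + B * (P * g * P ^ k)
          move : ∀ x y z → x - y ≡ z → x ≡ y + z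
          move x y z refl = solve 2 (λ x y → x := y :+ (x :- y)) x y
          F₁≡ : F₁ ≡ P * u + A * m
          F₁≡ = move F₁ (P * u) (A * m) eq₁
          F₂≡ : F₂ ≡ P * v + B * m
          F₂≡ = move F₂ (P * v) (B * m) eq₂
          F₂-factor : F₂ ≡ P * g * v″
          F₂-factor = trans F₂≡ (trans (cong₂ (λ v m → P * v + B * m) v≡ m≡)
            (solve 5 (λ P g v′ B q → P :* (g :* v′) :+ B :* (P :* (g :* (P :* g :* q)))
              := P :* g :* (v′ :+ B :* (P :* g :* q))) P g v′ B (P ^ k)))
          v″∤ : ¬ P ∣ v″
          v″∤ h = v′∤ (∣-resp-≡ (solve 5 (λ P g v′ B q → v′ := con 1ℤ :* (v′ :+ B :* (P :* g :* q)) :+ (:- (B :* g :* q)) :* P) P g v′ B (P ^ k))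
            (∣-lin₂ 1ℤ (- (B * g * P ^ k)) h ∣-refl))
          g≢0 : g ≢ 0ℤ
          g≢0 eq with ℤ.i^n≡0⇒i≡0 P j eq
          ... | ()
          Pg≢0 : P * g ≢ 0ℤ
          Pg≢0 eq = [ (λ ()) , g≢0 ]′ (ℤ.i*j≡0⇒i≡0∨j≡0 P eq)
          F₂≢0 : F₂ ≢ 0ℤ
          F₂≢0 eq = [ Pg≢0 , (λ v″≡0 → v″∤ (subst (P ∣_) (sym v″≡0) (divides 0ℤ refl))) ]′
            (ℤ.i*j≡0⇒i≡0∨j≡0 (P * g) (trans (sym F₂-factor) eq))
          r : ℚ
          r = (fromℤ F₁ ℚ.÷ fromℤ F₂) {{ℤ.≢-nonZero F₂≢0}}
          crossed : ↥ (y ℚ.- r) * (v * F₂) ≡ (u * F₂ - F₁ * v) * ↧ (y ℚ.- r)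
          crossed = cross-multiply (y ℚ.- r) (u * F₂ - F₁ * v) (v * F₂)
            (difference-of-fractions y r u v F₁ F₂ y*v (÷-cancel (fromℤ F₁) (fromℤ F₂) {{ℤ.≢-nonZero F₂≢0}}))
          G : ℤ
          G = g * (P * g)
          denominator : v * F₂ ≡ G * (v′ * v″)
          denominator = trans (cong₂ _*_ v≡ F₂-factor)
            (solve 4 (λ P g v′ v″ → g :* v′ :* (P :* g :* v″) := g :* (P :* g) :* (v′ :* v″)) P g v′ v″)
          numerator : u * F₂ - F₁ * v ≡ G * (P ^ k * (P * (u * B - A * v)))
          numerator = trans (cong₂ (λ F₁ F₂ → u * F₂ - F₁ * v) F₁≡ F₂≡)
            (trans (cong (λ m → u * (P * v + B * m) - (P * u + A * m) * v) m≡)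
            (solve 7 (λ P g q u v A B → u :* (P :* v :+ B :* (P :* (g :* (P :* g :* q)))) :- (P :* u :+ A :* (P :* (g :* (P :* g :* q)))) :* v
              := g :* (P :* g) :* (q :* (P :* (u :* B :- A :* v)))) P g (P ^ k) u v A B))
          cancelled : ↥ (y ℚ.- r) * (v′ * v″) ≡ P ^ k * (P * (u * B - A * v)) * ↧ (y ℚ.- r)
          cancelled = cancel G (↥ (y ℚ.- r)) (v′ * v″) (P ^ k * (P * (u * B - A * v))) (↧ (y ℚ.- r))
            (λ eq → [ g≢0 , Pg≢0 ]′ (ℤ.i*j≡0⇒i≡0∨j≡0 g eq))
            (trans (cong (↥ (y ℚ.- r) *_) (sym denominator)) (trans crossed (cong (_* ↧ (y ℚ.- r)) numerator)))
            where
            cancel : ∀ G s t w z → G ≢ 0ℤ → s * (G * t) ≡ G * w * z → s * t ≡ w * z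
            cancel G s t w z G≢0 eq = ℤ.*-cancelˡ-≡ G (s * t) (w * z) {{ℤ.≢-nonZero G≢0}}
              (trans (solve 3 (λ G s t → G :* (s :* t) := s :* (G :* t)) G s t) (trans eq (ℤ.*-assoc G w z)))

    -- A term of the Cauchy sequence after which all terms agree to precision `k` stands in for the
    -- limit.
    dense : DenseInℚₚ p (R (quartic a b c d e))
    dense x k =
      let N , close = cauchy x k
          r , r∈R , close′ = approximate k (seq x N)
      in r , r∈R , N , λ m N≤m → close-trans k (seq x m) (seq x N) r (close m N N≤m ℕ.≤-refl) close′

-- From the hypotheses on the form to a simple root

module Reduction {n : ℕ} (p-prime : Prime (suc n)) (2<p : 2 ℕ.< suc n) (a b c d e : ℤ) where
  open PrimeModulus p-prime
  open Resolvent p-prime 2<p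

  q r σ : ℤ
  q = a * c
  r = a * a * d
  σ = a * a * a * e

  module _ (P∣b : P ∣ b) (no-root : ∀ t → ¬ P ∣ resolvent q r σ t) where
    open Pencil p-prime 2<p q r σ no-root
    open Hensel p-prime a b c d e using (f; f′)

    -- If p divided `a`, then r = a²d ≡ 0 and g(0) = -r² ≡ 0.
    a∤ : ¬ P ∣ a
    a∤ h = no-root 0ℤ (∣-resp-≡
      (solve 4 (λ a c d e → let q = a :* c ; r = a :* a :* d ; σ = a :* a :* a :* e ; t = con 0ℤ in
         t :* t :* t :+ con (+ 2) :* q :* (t :* t) :+ (q :* q :- con (+ 4) :* σ) :* t :- r :* r
         := (:- (a :* d :* (a :* a :* d))) :* a) a c d e)
      (∣n⇒∣m*n (- (a * d * (a * a * d))) h))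

    -- a³ F(x , 1) ≡ depressed (a x) modulo b
    quartic-root : ∀ x → P ∣ depressed q r σ (a * x) → P ∣ f x
    quartic-root x h = ∤-cancelˡ (∤-* a∤ (∤-* a∤ a∤)) (∣-resp-≡
      (solve 6 (λ a b c d e x → let q = a :* c ; r = a :* a :* d ; σ = a :* a :* a :* e ; y = a :* x in
         a :* (a :* a) :* (a :* x :^ 4 :+ b :* x :^ 3 :* con 1ℤ :+ c :* x :^ 2 :* con 1ℤ :^ 2 :+ d :* x :* con 1ℤ :^ 3 :+ e :* con 1ℤ :^ 4)
         := con 1ℤ :* (y :* y :* y :* y :+ q :* (y :* y) :+ r :* y :+ σ) :+ (a :* a :* a :* (x :* x :* x)) :* b) a b c d e x)
      (∣-lin₂ 1ℤ (a * a * a * (x * x * x)) h P∣b))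

    -- Differentiating a³F(x, 1) ≡ depressed(ax) and cancelling `a` shows that a² f′(x) is the
    -- derivative of the depressed quartic at ax, modulo `b`.
    quartic-root-simple : ∀ x → P ∣ depressed q r σ (a * x) → ¬ P ∣ f′ x
    quartic-root-simple x h h′ = depressed-root-simple (a * x) h (∣-resp-≡
      (solve 5 (λ a b c d x → let q = a :* c ; r = a :* a :* d ; y = a :* x in
         con (+ 4) :* (y :* y :* y) :+ con (+ 2) :* q :* y :+ r
         := (a :* a) :* (con (+ 4) :* a :* (x :* x :* x) :+ con (+ 3) :* b :* (x :* x) :+ con (+ 2) :* c :* x :+ d)
            :+ (:- (con (+ 3) :* (a :* a) :* (x :* x))) :* b) a b c d x)
      (∣-lin₂ (a * a) (- (+ 3 * (a * a) * (x * x))) h′ P∣b))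

    dense-ratios : DenseInℚₚ p (R (quartic a b c d e))
    dense-ratios =
      let y , hy = depressed-root
          a′ , aa′ = inverse a a∤
          h = depressed-cong y (a * (a′ * y)) (∣-resp-≡
            (solve 3 (λ a a′ y → y :- a :* (a′ :* y) := (:- y) :* (a :* a′ :- con 1ℤ)) a a′ y)
            (∣n⇒∣m*n (- y) aa′)) hy
      in Density.dense p-prime a b c d e (a′ * y) (quartic-root (a′ * y) h) (quartic-root-simple (a′ * y) h)

  no-root-case₁ : (a ^ 2 * c ^ 2 + + 12 * a ^ 3 * e ≡ 0ℤ mod p) →
    CubicNonResidue p (+ 8 * a ^ 3 * c ^ 3 + + 27 * a ^ 4 * d ^ 2) → ∀ t → ¬ P ∣ resolvent q r σ t
  no-root-case₁ h noncube = no-root-if-noncube q r σ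
    (∣-resp-≡ (solve 3 (λ a c e → a :* c :* (a :* c) :+ con (+ 12) :* (a :* a :* a :* e)
       := a :^ 2 :* c :^ 2 :+ con (+ 12) :* a :^ 3 :* e :- con 0ℤ) a c e) (∣ᵤ⇒∣ h))
    (λ t ht → noncube (t , ∣⇒∣ᵤ (∣-resp-≡
      (solve 4 (λ a c d t → let q = a :* c ; r = a :* a :* d in
        t :^ 3 :- (con (+ 8) :* a :^ 3 :* c :^ 3 :+ con (+ 27) :* a :^ 4 :* d :^ 2)
        := t :* t :* t :- (con (+ 8) :* (q :* q :* q) :+ con (+ 27) :* (r :* r))) a c d t) ht)))

  no-root-case₂ : ¬ (a ^ 2 * c ^ 2 + + 12 * a ^ 3 * e ≡ 0ℤ mod p) →
    (s a c d e (p ℕ.+ 1) ≡ a ^ 2 * c ^ 2 - + 4 * a ^ 3 * e mod p) → ∀ t → ¬ P ∣ resolvent q r σ t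
  no-root-case₂ h hs = no-root-if-power-sum a c d e
    (λ h′ → h (∣⇒∣ᵤ (∣-resp-≡ (solve 3 (λ a c e → a :^ 2 :* c :^ 2 :+ con (+ 12) :* a :^ 3 :* e :- con 0ℤ
       := a :* c :* (a :* c) :+ con (+ 12) :* (a :* a :* a :* e)) a c e) h′)))
    (∣-resp-≡ (solve 4 (λ S a c e → S :- (a :* c :* (a :* c) :- con (+ 4) :* (a :* a :* a :* e))
       := S :- (a :^ 2 :* c :^ 2 :- con (+ 4) :* a :^ 3 :* e)) (s a c d e (suc p)) a c e)
      (∣ᵤ⇒∣ (subst (λ k → s a c d e k ≡ a ^ 2 * c ^ 2 - + 4 * a ^ 3 * e mod p) (ℕ.+-comm p 1) hs)))

theorem5p6 : ∀ (a b c d e : ℤ) → a ≢ 0ℤ → b ≢ 0ℤ →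
    ∀ (p : ℕ) → Prime p → 3 ℕ.< p → Positive (ν p (fromℤ b)) →
    ( (+ p ≡ 1ℤ mod 3)
    × (a ^ 2 * c ^ 2 + + 12 * a ^ 3 * e ≡ 0ℤ mod p)
    × CubicNonResidue p (+ 8 * a ^ 3 * c ^ 3 + + 27 * a ^ 4 * d ^ 2) )
    ⊎
    ( (¬ (a ^ 2 * c ^ 2 + + 12 * a ^ 3 * e ≡ 0ℤ mod p))
    × (s a c d e (p ℕ.+ 1) ≡ a ^ 2 * c ^ 2 - + 4 * a ^ 3 * e mod p) ) →
    DenseInℚₚ p (R (quartic a b c d e))
theorem5p6 a b c d e _ _ zero _ () _ _
theorem5p6 a b c d e _ _ (suc n) p-prime 3<p ν>0 cases =
  dense-ratios (Valuation.positive⇒∣ p-prime b ν>0)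
    ([ (λ (_ , h , noncube) → no-root-case₁ h noncube) , (λ (h , hs) → no-root-case₂ h hs) ]′ cases)
  where
  open Reduction p-prime (ℕ.<-trans (ℕ.n<1+n 2) 3<p) a b c d e
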